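{- For every $\varepsilon \in (0,1)$ there exists $t_0=t_0(\varepsilon)$ such that for every integer $t \ge t_0$ there exists a graph $G$ which does not contain $K_t$ as a minor and whose list chromatic number satisfies $\chi_\ell(G) \ge (2-\varepsilon)t$.
   Context: All graphs are finite and simple. A graph $G$ contains $K_t$ as a minor if it has a subgraph whose vertex set can be partitioned into $t$ pairwise disjoint non-empty sets $Z_1,\ldots,Z_t$ such that each induced subgraph $G[Z_i]$ is connected and for every two distinct $i,j$ there is an edge of $G$ between $Z_i$ and $Z_j$. A list assignment $L$ assigns a finite set $L(v)\subseteq \mathbb{N}$ to each vertex $v$; an $L$-coloring is a proper coloring $c$ with $c(v)\in L(v)$ for all $v$. The list chromatic number $\chi_\ell(G)$ is the smallest $k\ge 1$ such that $G$ has an $L$-coloring for every list assignment $L$ with $|L(v)|\ge k$ for all $v$. -}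

module Defs where

open import Data.Nat using (ℕ; _≤_; _<_)
open import Data.Fin using (Fin)
open import Data.Maybe using (Maybe; just)
open import Data.List using (List; length)
open import Data.List.Membership.Propositional using (_∈_)
open import Data.List.Relation.Unary.Unique.Propositional using (Unique)
open import Data.Product using (Σ; ∃; ∃-syntax; _×_)
open import Relation.Nullary using (¬_)
open import Relation.Binary.PropositionalEquality using (_≡_)

record Graph : Set₁ where
  field
    n      : ℕ
    Adj    : Fin n → Fin n → Set
    sym    : ∀ {u v} → Adj u v → Adj v u
    irrefl : ∀ {u} → ¬ Adj u u

module _ (G : Graph) where
  open Graph G

  data WalkIn (P : Fin n → Set) : Fin n → Fin n → Set where
    here : ∀ {u} → P u → WalkIn P u u
    step : ∀ {u w v} → P u → Adj u w → WalkIn P w v → WalkIn P u v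

  -- G contains K_t as a minor: there are pairwise disjoint non-empty
  -- branch sets Z_1,…,Z_t (encoded by a partial map Z : V → Maybe (Fin t),
  -- Z_i = {v | Z v ≡ just i}, so disjointness is automatic), each
  -- inducing a connected subgraph, with an edge between any two distinct ones.
  HasKMinor : ℕ → Set
  HasKMinor t =
    Σ (Fin n → Maybe (Fin t)) λ Z →
      (∀ i → ∃[ v ] Z v ≡ just i) ×
      (∀ i u v → Z u ≡ just i → Z v ≡ just i →
         WalkIn (λ w → Z w ≡ just i) u v) ×
      (∀ i j → ¬ i ≡ j →
         ∃[ u ] ∃[ v ] (Z u ≡ just i × Z v ≡ just j × Adj u v))

  -- A list assignment: finite sets of naturals, represented as
  -- duplicate-free lists.
  ListAssignment : Set
  ListAssignment = Fin n → List ℕ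

  IsLColoring : ListAssignment → (Fin n → ℕ) → Set
  IsLColoring L c = (∀ v → c v ∈ L v) × (∀ u v → Adj u v → ¬ c u ≡ c v)

  Choosable : ℕ → Set
  Choosable k = ∀ (L : ListAssignment) →
    (∀ v → Unique (L v)) → (∀ v → k ≤ length (L v)) →
    ∃[ c ] IsLColoring L c

  IsListChromaticNumber : ℕ → Set
  IsListChromaticNumber k =
    1 ≤ k × Choosable k × (∀ j → 1 ≤ j → j < k → ¬ Choosable j)

-- Write t = n + 2u with u proportional to t, and let A and B be cliques of size n joined by a bipartite
-- graph in which each pair a, b is missing with a small constant probability.  If this graph had t disjoint,
-- pairwise adjacent vertex sets, at most n of them would meet B and at most n would meet A, leaving 2u
-- sets inside A and 2u inside B, at least u of each of bounded size.  For given families the probability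
-- that all these pairs of sets are joined is exp(-Ω(t²)), whereas there are only exp(O(t log t)) families.
--
-- Glue along A one copy of B for each colouring of A with 2n - 1 colours, deleting from the lists in
-- that copy the few colours of non-neighbours in A.  A colouring of A then leaves fewer than n colours for
-- its copy of B.  Gluing along a clique creates no new clique minor.
module Submission where

open import Defs
open import Data.Bool using (Bool; true; false; if_then_else_; _∧_)
open import Data.Fin using (Fin; zero; suc)
open import Data.List using (List; []; _∷_; length; allFin; filter)
open import Data.List.Membership.Propositional using (_∈_)
open import Data.List.Relation.Unary.Unique.Propositional using (Unique)
open import Data.Maybe using (Maybe; just; nothing)
open import Data.Product using (Σ; ∃; ∃-syntax; _×_; _,_; proj₁; proj₂)
open import Data.Sum using (_⊎_; inj₁; inj₂)
open import Function using (_∘_; id)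
open import Relation.Nullary using (¬_; Dec; yes; no; does; contradiction)
open import Relation.Unary using (Decidable)
open import Relation.Binary.PropositionalEquality

-- The lists need every vertex of `B` to have few non-neighbours, not merely few on average, which
-- for a random graph would call for a concentration bound. Here the random object is a table `h`
-- with entries in `Fin q`, and `a`, `b` are non-adjacent when `h a b ≡ c b`, where `c b` is a value
-- that pigeonhole shows to be rare in column `b`. As `c` depends on `h`, the union bound runs over
-- all `c` too, which costs only a factor `q ^ n`. For fixed labellings and fixed `c`, distinct
-- pairs of labels own disjoint blocks of cells, so their events are independent; probabilities
-- appear as counts of tables with denominators cleared. The labellings carry no connectivity
-- condition: connectivity of branch sets serves only to confine those avoiding `A` to one copy of
-- `B`. The statement asks for the value of the list chromatic number. To produce it constructively,
-- choosability must be decided, although lists range over all of `ℕ`.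

-- Finite sums, indicators and enumeration of vectors.

module FiniteSums where

  open import Data.Nat
  open import Data.Nat.Properties
  open import Data.Nat.Tactic.RingSolver using (solve-∀)
  open import Data.Nat.ListAction using (sum)
  open import Data.Fin using (combine; _↑ˡ_; _↑ʳ_)
  import Data.Fin.Properties as Fin
  open import Data.List using (map; cartesianProductWith; _++_)
  open import Data.List.Properties using (map-tabulate)
  open import Data.List.Membership.Propositional.Properties using (∈-cartesianProductWith⁺)
  open import Data.List.Relation.Unary.Any using (here; there)
  open import Data.Vec using (Vec; []; _∷_)

  private variable
    A B C : Set

  ∑ : List A → (A → ℕ) → ℕ
  ∑ xs f = sum (map f xs)

  bit : Bool → ℕ
  bit b = if b then 1 else 0

  𝟙 : {P : Set} → Dec P → ℕ
  𝟙 P? = bit (does P?)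

  𝟙-yes : {P : Set} (P? : Dec P) → P → 𝟙 P? ≡ 1
  𝟙-yes (yes _) _ = refl
  𝟙-yes (no ¬p) p = contradiction p ¬p

  𝟙-pos : {P : Set} (P? : Dec P) → 1 ≤ 𝟙 P? → P
  𝟙-pos (yes p) _ = p

  +-interchange : ∀ a b c d → (a + b) + (c + d) ≡ (a + c) + (b + d)
  +-interchange = solve-∀

  ∑-cong : (xs : List A) {f g : A → ℕ} → (∀ x → f x ≡ g x) → ∑ xs f ≡ ∑ xs g
  ∑-cong []       eq = refl
  ∑-cong (x ∷ xs) eq = cong₂ _+_ (eq x) (∑-cong xs eq)

  ∑-mono : (xs : List A) {f g : A → ℕ} → (∀ x → f x ≤ g x) → ∑ xs f ≤ ∑ xs g
  ∑-mono []       le = z≤n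
  ∑-mono (x ∷ xs) le = +-mono-≤ (le x) (∑-mono xs le)

  ∑-+ : (xs : List A) (f g : A → ℕ) → ∑ xs (λ x → f x + g x) ≡ ∑ xs f + ∑ xs g
  ∑-+ []       f g = refl
  ∑-+ (x ∷ xs) f g rewrite ∑-+ xs f g = +-interchange (f x) (g x) (∑ xs f) (∑ xs g)

  ∑-*ʳ : (xs : List A) (f : A → ℕ) (c : ℕ) → ∑ xs (λ x → f x * c) ≡ ∑ xs f * c
  ∑-*ʳ []       f c = refl
  ∑-*ʳ (x ∷ xs) f c rewrite ∑-*ʳ xs f c = sym (*-distribʳ-+ c (f x) (∑ xs f))

  ∑-*ˡ : (xs : List A) (f : A → ℕ) (c : ℕ) → ∑ xs (λ x → c * f x) ≡ c * ∑ xs f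
  ∑-*ˡ xs f c = trans (∑-cong xs λ x → *-comm c (f x)) (trans (∑-*ʳ xs f c) (*-comm _ c))

  ∑-0 : (xs : List A) → ∑ xs (λ _ → 0) ≡ 0
  ∑-0 []       = refl
  ∑-0 (x ∷ xs) = ∑-0 xs

  ∑-const : (xs : List A) (c : ℕ) → ∑ xs (λ _ → c) ≡ length xs * c
  ∑-const []       c = refl
  ∑-const (x ∷ xs) c = cong (c +_) (∑-const xs c)

  ∑-comm : (xs : List A) (ys : List B) (f : A → B → ℕ) →
           ∑ xs (λ x → ∑ ys (f x)) ≡ ∑ ys (λ y → ∑ xs (λ x → f x y))
  ∑-comm []       ys f = sym (∑-0 ys)
  ∑-comm (x ∷ xs) ys f rewrite ∑-comm xs ys f = sym (∑-+ ys (f x) _)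

  ∑-++ : (xs ys : List A) (f : A → ℕ) → ∑ (xs ++ ys) f ≡ ∑ xs f + ∑ ys f
  ∑-++ []       ys f = refl
  ∑-++ (x ∷ xs) ys f rewrite ∑-++ xs ys f = sym (+-assoc (f x) _ _)

  ∑-map : (h : A → B) (xs : List A) (f : B → ℕ) → ∑ (map h xs) f ≡ ∑ xs (f ∘ h)
  ∑-map h []       f = refl
  ∑-map h (x ∷ xs) f = cong (f (h x) +_) (∑-map h xs f)

  ∑-cartesianProductWith : (h : A → B → C) (xs : List A) (ys : List B) (f : C → ℕ) →
    ∑ (cartesianProductWith h xs ys) f ≡ ∑ xs (λ x → ∑ ys (λ y → f (h x y)))
  ∑-cartesianProductWith h []       ys f = refl
  ∑-cartesianProductWith h (x ∷ xs) ys f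
    rewrite ∑-++ (map (h x) ys) (cartesianProductWith h xs ys) f
          | ∑-map (h x) ys f
          | ∑-cartesianProductWith h xs ys f = refl

  -- The averaging principle: it supplies the good table in `random-table` and the rare value in
  -- `rare-value`.
  ∑-< : (xs : List A) (f g : A → ℕ) → ∑ xs f < ∑ xs g → ∃[ x ] f x < g x
  ∑-< (x ∷ xs) f g lt with f x <? g x
  ... | yes p = x , p
  ... | no ¬p = ∑-< xs f g (≰⇒> λ le → <⇒≱ lt (+-mono-≤ (≮⇒≥ ¬p) le))

  ∑≡0⇒ : (xs : List A) (f : A → ℕ) → ∑ xs f ≡ 0 → ∀ {x} → x ∈ xs → f x ≡ 0
  ∑≡0⇒ (x ∷ xs) f eq (here refl) = m+n≡0⇒m≡0 (f x) eq
  ∑≡0⇒ (x ∷ xs) f eq (there x∈)  = ∑≡0⇒ xs f (m+n≡0⇒n≡0 (f x) eq) x∈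

  ∑-∈ : (xs : List A) (f : A → ℕ) → ∀ {x} → x ∈ xs → f x ≤ ∑ xs f
  ∑-∈ (x ∷ xs) f (here refl) = m≤m+n (f x) _
  ∑-∈ (x ∷ xs) f (there x∈)  = ≤-trans (∑-∈ xs f x∈) (m≤n+m _ (f x))

  length-filter-∑ : {P : A → Set} (P? : Decidable P) (xs : List A) →
                    length (filter P? xs) ≡ ∑ xs (λ x → 𝟙 (P? x))
  length-filter-∑ P? []       = refl
  length-filter-∑ P? (x ∷ xs) with P? x
  ... | yes _ = cong suc (length-filter-∑ P? xs)
  ... | no  _ = length-filter-∑ P? xs

  ∑-allFin-suc : ∀ n (f : Fin (suc n) → ℕ) → ∑ (allFin (suc n)) f ≡ f zero + ∑ (allFin n) (f ∘ suc)
  ∑-allFin-suc n f = cong (f zero +_)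
    (cong sum (trans (map-tabulate suc f) (sym (map-tabulate id (f ∘ suc)))))

  ∑-allFin-+ : ∀ m n (f : Fin (m + n) → ℕ) →
               ∑ (allFin (m + n)) f ≡ ∑ (allFin m) (λ i → f (i ↑ˡ n)) + ∑ (allFin n) (λ j → f (m ↑ʳ j))
  ∑-allFin-+ zero    n f = refl
  ∑-allFin-+ (suc m) n f
    rewrite ∑-allFin-suc (m + n) f | ∑-allFin-suc m (λ i → f (i ↑ˡ n)) | ∑-allFin-+ m n (f ∘ suc)
    = sym (+-assoc (f zero) _ _)

  ∑-allFin-combine : ∀ m n (f : Fin (m * n) → ℕ) →
                     ∑ (allFin (m * n)) f ≡ ∑ (allFin m) (λ a → ∑ (allFin n) (λ b → f (combine a b)))
  ∑-allFin-combine zero    n f = refl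
  ∑-allFin-combine (suc m) n f
    rewrite ∑-allFin-+ n (m * n) f | ∑-allFin-suc m (λ a → ∑ (allFin n) (λ b → f (combine a b)))
          | ∑-allFin-combine m n (λ k → f (n ↑ʳ k)) = refl

  ∑-allFin-≟ : ∀ {n} (v : Fin n) → ∑ (allFin n) (λ x → 𝟙 (v Fin.≟ x)) ≡ 1
  ∑-allFin-≟ {suc n} zero    rewrite ∑-allFin-suc n (λ x → 𝟙 (zero Fin.≟ x)) =
    cong suc (∑-0 (allFin n))
  ∑-allFin-≟ {suc n} (suc v) rewrite ∑-allFin-suc n (λ x → 𝟙 (suc v Fin.≟ x)) =
    trans (∑-cong (allFin n) λ x → refl) (∑-allFin-≟ v)

  ∑-allFin-1 : ∀ n → ∑ (allFin n) (λ _ → 1) ≡ n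
  ∑-allFin-1 zero    = refl
  ∑-allFin-1 (suc n) = trans (∑-allFin-suc n (λ _ → 1)) (cong suc (∑-allFin-1 n))

  -- Vectors stand in for functions because `∈-vecs` needs propositional equality, where functions
  -- would agree only pointwise.
  vecs : List A → ∀ n → List (Vec A n)
  vecs xs zero    = [] ∷ []
  vecs xs (suc n) = cartesianProductWith _∷_ xs (vecs xs n)

  ∈-vecs : {xs : List A} → (∀ x → x ∈ xs) → ∀ {n} (v : Vec A n) → v ∈ vecs xs n
  ∈-vecs all []      = here refl
  ∈-vecs all (x ∷ v) = ∈-cartesianProductWith⁺ _∷_ (all x) (∈-vecs all v)

  ∑-vecs-suc : (xs : List A) (n : ℕ) (f : Vec A (suc n) → ℕ) →
               ∑ (vecs xs (suc n)) f ≡ ∑ xs (λ x → ∑ (vecs xs n) (λ v → f (x ∷ v)))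
  ∑-vecs-suc xs n f = ∑-cartesianProductWith _∷_ xs (vecs xs n) f

  ∑-vecs-1 : (xs : List A) (n : ℕ) → ∑ (vecs xs n) (λ _ → 1) ≡ (∑ xs (λ _ → 1)) ^ n
  ∑-vecs-1 xs zero    = refl
  ∑-vecs-1 xs (suc n) = begin
    ∑ (vecs xs (suc n)) (λ _ → 1)            ≡⟨ ∑-vecs-suc xs n _ ⟩
    ∑ xs (λ _ → ∑ (vecs xs n) (λ _ → 1))     ≡⟨ ∑-cong xs (λ _ → trans (∑-vecs-1 xs n) (sym (*-identityˡ _))) ⟩
    ∑ xs (λ _ → 1 * (∑ xs (λ _ → 1)) ^ n)    ≡⟨ ∑-*ʳ xs _ _ ⟩
    (∑ xs (λ _ → 1)) ^ suc n                 ∎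
    where open ≡-Reasoning

-- Independence of events on disjoint sets of cells, by counting.

module IndependentCells where

  open FiniteSums
  open import Data.Nat
  open import Data.Nat.Properties
  open import Data.Nat.Tactic.RingSolver using (solve-∀)
  import Data.Fin.Properties as Fin
  open import Data.List.Relation.Unary.Any using (here; there)
  open import Data.List.Relation.Unary.All using (All; []; _∷_)
  open import Data.List.Relation.Unary.AllPairs using ([]; _∷_)
  open import Data.Vec using (Vec; []; _∷_; lookup)

  private variable
    A : Set
    q N : ℕ

  slot : Bool → Fin q → Fin q → ℕ
  slot false v x = 1
  slot true  v x = 𝟙 (v Fin.≟ x)

  -- The 0-1 indicator that `h` agrees with `v` on the cells of `X`, written as a product so that
  -- sums over `vecs` split one coordinate at a time.
  match : (Fin N → Bool) → (Fin N → Fin q) → Vec (Fin q) N → ℕ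
  match X v []      = 1
  match X v (x ∷ h) = slot (X zero) (v zero) x * match (X ∘ suc) (v ∘ suc) h

  AgreeOff : (Fin N → Bool) → (h h′ : Vec (Fin q) N) → Set
  AgreeOff X h h′ = ∀ k → X k ≡ false → lookup h k ≡ lookup h′ k

  IndependentOf : (Fin N → Bool) → (Vec (Fin q) N → ℕ) → Set
  IndependentOf X f = ∀ {h h′} → AgreeOff X h h′ → f h ≡ f h′

  size : (Fin N → Bool) → ℕ
  size {N} X = ∑ (allFin N) (bit ∘ X)

  slot≤1 : ∀ b (v x : Fin q) → slot b v x ≤ 1
  slot≤1 false v x = ≤-refl
  slot≤1 true  v x with v Fin.≟ x
  ... | yes _ = ≤-refl
  ... | no  _ = z≤n

  match≤1 : (X : Fin N → Bool) (v : Fin N → Fin q) (h : Vec (Fin q) N) → match X v h ≤ 1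
  match≤1 X v []      = ≤-refl
  match≤1 X v (x ∷ h) = *-mono-≤ (slot≤1 (X zero) (v zero) x) (match≤1 (X ∘ suc) (v ∘ suc) h)

  *-posˡ : ∀ a b → 1 ≤ a * b → 1 ≤ a
  *-posˡ (suc a) b _ = s≤s z≤n

  *-posʳ : ∀ a b → 1 ≤ a * b → 1 ≤ b
  *-posʳ a b pos = *-posˡ b a (subst (1 ≤_) (*-comm a b) pos)

  match-pos : (X : Fin N → Bool) (v : Fin N → Fin q) (h : Vec (Fin q) N) → 1 ≤ match X v h →
              ∀ k → X k ≡ true → v k ≡ lookup h k
  match-pos X v (x ∷ h) pos zero    X0 =
    𝟙-pos (v zero Fin.≟ x) (subst (λ b → 1 ≤ slot b (v zero) x) X0 (*-posˡ _ _ pos))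
  match-pos X v (x ∷ h) pos (suc k) Xk =
    match-pos (X ∘ suc) (v ∘ suc) h (*-posʳ (slot (X zero) (v zero) x) _ pos) k Xk

  match-cong : (Y : Fin N → Bool) (v : Fin N → Fin q) (h h′ : Vec (Fin q) N) →
               (∀ k → Y k ≡ true → lookup h k ≡ lookup h′ k) → match Y v h ≡ match Y v h′
  match-cong Y v []      []        eq = refl
  match-cong Y v (x ∷ h) (x′ ∷ h′) eq =
    cong₂ _*_ (slot-cong (Y zero) (eq zero)) (match-cong (Y ∘ suc) (v ∘ suc) h h′ (eq ∘ suc))
    where
    slot-cong : ∀ b → (b ≡ true → x ≡ x′) → slot b (v zero) x ≡ slot b (v zero) x′
    slot-cong false _  = refl
    slot-cong true  eq = cong (slot true (v zero)) (eq refl)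

  -- Matching on `X` has probability `1 / q ^ size X` and is independent of anything that ignores
  -- the cells of `X`.
  ∑-match : (X : Fin N → Bool) (v : Fin N → Fin q) (f : Vec (Fin q) N → ℕ) → IndependentOf X f →
    ∑ (vecs (allFin q) N) (λ h → f h * match X v h) * q ^ size X ≡ ∑ (vecs (allFin q) N) f
  ∑-match {zero}  {q} X v f ind = unit (f [])
    where
    unit : ∀ a → (a * 1 + 0) * 1 ≡ a + 0
    unit = solve-∀
  ∑-match {suc N} {q} X v f ind = begin
    ∑ (vecs (allFin q) (suc N)) (λ h → f h * match X v h) * q ^ size X
      ≡⟨ cong₂ (λ a b → a * q ^ b) (∑-vecs-suc (allFin q) N _) (∑-allFin-suc N (bit ∘ X)) ⟩
    ∑ (allFin q) (λ x → ∑ hs (λ h → f (x ∷ h) * (slot (X zero) (v zero) x * match X′ v′ h)))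
      * q ^ (bit (X zero) + size X′)
      ≡⟨ split-first (X zero) refl ⟩
    ∑ (allFin q) (λ x → ∑ hs (λ h → f (x ∷ h)))
      ≡⟨ ∑-vecs-suc (allFin q) N f ⟨
    ∑ (vecs (allFin q) (suc N)) f ∎
    where
    open ≡-Reasoning
    hs = vecs (allFin q) N
    X′ = X ∘ suc
    v′ = v ∘ suc

    ind-tail : ∀ x → IndependentOf X′ (λ h → f (x ∷ h))
    ind-tail x eq = ind λ { zero _ → refl ; (suc k) Xk → eq k Xk }

    ∑-slot : ∀ b x → ∑ hs (λ h → f (x ∷ h) * (slot b (v zero) x * match X′ v′ h))
                   ≡ slot b (v zero) x * ∑ hs (λ h → f (x ∷ h) * match X′ v′ h)
    ∑-slot b x = trans (∑-cong hs λ h → swap (f (x ∷ h)) (slot b (v zero) x) _) (∑-*ˡ hs _ (slot b (v zero) x))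
      where
      swap : ∀ a b c → a * (b * c) ≡ b * (a * c)
      swap = solve-∀

    split-first : ∀ b → X zero ≡ b →
      ∑ (allFin q) (λ x → ∑ hs (λ h → f (x ∷ h) * (slot b (v zero) x * match X′ v′ h)))
        * q ^ (bit b + size X′)
      ≡ ∑ (allFin q) (λ x → ∑ hs (λ h → f (x ∷ h)))
    split-first false _ = begin
      _ ≡⟨ ∑-*ʳ (allFin q) _ (q ^ size X′) ⟨
      ∑ (allFin q) (λ x → ∑ hs (λ h → f (x ∷ h) * (1 * match X′ v′ h)) * q ^ size X′)
        ≡⟨ ∑-cong (allFin q) (λ x → trans
             (cong (_* q ^ size X′) (trans (∑-slot false x) (*-identityˡ _)))
             (∑-match X′ v′ (λ h → f (x ∷ h)) (ind-tail x))) ⟩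
      _ ∎
    -- Only the entry `x = v zero` survives the indicator. Since `f` ignores this cell, the spare
    -- factor `q` turns that single term into the sum over all `x`.
    split-first true X0 = begin
      ∑ (allFin q) (λ x → ∑ hs (λ h → f (x ∷ h) * (slot true (v zero) x * match X′ v′ h))) * q ^ suc (size X′)
        ≡⟨ cong (_* q ^ suc (size X′)) (trans
             (∑-cong (allFin q) λ x → trans (∑-slot true x)
               (cong (slot true (v zero) x *_) (∑-cong hs λ h → cong (_* match X′ v′ h) (same x h))))
             (∑-*ʳ (allFin q) _ S)) ⟩
      ∑ (allFin q) (λ x → 𝟙 (v zero Fin.≟ x)) * S * q ^ suc (size X′)
        ≡⟨ cong (λ z → z * S * q ^ suc (size X′)) (∑-allFin-≟ (v zero)) ⟩
      1 * S * (q * q ^ size X′)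
        ≡⟨ rearrange S q (q ^ size X′) ⟩
      q * (S * q ^ size X′)
        ≡⟨ cong (q *_) (∑-match X′ v′ (λ h → f (v zero ∷ h)) (ind-tail (v zero))) ⟩
      q * T
        ≡⟨ cong (_* T) (∑-allFin-1 q) ⟨
      ∑ (allFin q) (λ _ → 1) * T
        ≡⟨ ∑-*ʳ (allFin q) (λ _ → 1) T ⟨
      ∑ (allFin q) (λ _ → 1 * T)
        ≡⟨ ∑-cong (allFin q) (λ x → trans (*-identityˡ T) (∑-cong hs λ h → sym (same x h))) ⟩
      ∑ (allFin q) (λ x → ∑ hs (λ h → f (x ∷ h))) ∎
      where
      S = ∑ hs (λ h → f (v zero ∷ h) * match X′ v′ h)
      T = ∑ hs (λ h → f (v zero ∷ h))
      same : ∀ x h → f (x ∷ h) ≡ f (v zero ∷ h)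
      same x h = ind λ { zero X0′ → contradiction (trans (sym X0) X0′) λ() ; (suc k) _ → refl }
      rearrange : ∀ S q p → 1 * S * (q * p) ≡ q * (S * p)
      rearrange = solve-∀

  module _ (X : A → Fin N → Bool) (v : Fin N → Fin q)
           (disjoint : ∀ {g g′} k → X g k ≡ true → X g′ k ≡ true → g ≡ g′) where

    -- The indicator that, for every listed `g`, the vector `h` differs from `v` somewhere on `X g`.
    miss : List A → Vec (Fin q) N → ℕ
    miss []       h = 1
    miss (g ∷ gs) h = miss gs h * (1 ∸ match (X g) v h)

    miss≤1 : ∀ gs h → miss gs h ≤ 1
    miss≤1 []       h = ≤-refl
    miss≤1 (g ∷ gs) h = *-mono-≤ (miss≤1 gs h) (m∸n≤m 1 (match (X g) v h))

    miss≡0 : ∀ gs h → miss gs h ≡ 0 → ∃[ g ] g ∈ gs × (∀ k → X g k ≡ true → v k ≡ lookup h k)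
    miss≡0 (g ∷ gs) h eq
      with m*n≡0⇒m≡0∨n≡0 (miss gs h) eq
    ... | inj₁ e = let (g′ , g′∈ , p) = miss≡0 gs h e in g′ , there g′∈ , p
    ... | inj₂ e = g , here refl , match-pos (X g) v h (m∸n≡0⇒m≤n {1} {match (X g) v h} e)

    miss-independent : ∀ g gs → All (g ≢_) gs → IndependentOf (X g) (miss gs)
    miss-independent g []        []         eq = refl
    miss-independent g (g′ ∷ gs) (g≢ ∷ g∉) {h} {h′} eq =
      cong₂ (λ a b → a * (1 ∸ b)) (miss-independent g gs g∉ eq)
        (match-cong (X g′) v h h′ λ k Xg′k → eq k (off k Xg′k))
      where
      off : ∀ k → X g′ k ≡ true → X g k ≡ false
      off k Xg′k with X g k in e
      ... | false = refl
      ... | true  = contradiction (disjoint k e Xg′k) g≢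

    -- Each set is matched with probability at least `1 / q ^ R`, hence at least `1 / suc M`. By
    -- independence, `G` sets are all missed with probability at most `(M / suc M) ^ G`.
    ∑-miss : ∀ M R → q ^ R ≤ suc M → 1 ≤ q → ∀ G gs → Unique gs → All (λ g → size (X g) ≤ R) gs → G ≤ length gs →
             ∑ (vecs (allFin q) N) (miss gs) * suc M ^ G ≤ M ^ G * q ^ N
    ∑-miss M R M≡ 1≤q zero gs _ _ _ = begin
      ∑ hs (miss gs) * 1      ≡⟨ *-identityʳ _ ⟩
      ∑ hs (miss gs)          ≤⟨ ∑-mono hs (miss≤1 gs) ⟩
      ∑ hs (λ _ → 1)          ≡⟨ ∑-vecs-1 (allFin q) N ⟩
      ∑ (allFin q) (λ _ → 1) ^ N ≡⟨ cong (_^ N) (∑-allFin-1 q) ⟩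
      q ^ N                   ≡⟨ *-identityˡ _ ⟨
      1 * q ^ N               ∎
      where
      open ≤-Reasoning
      hs = vecs (allFin q) N
    ∑-miss M R M≡ 1≤q (suc G) (g ∷ gs) (g∉ ∷ uniq) (sz ∷ szs) (s≤s G≤) = begin
      U * (suc M * suc M ^ G)    ≡⟨ *-assoc U (suc M) (suc M ^ G) ⟨
      U * suc M * suc M ^ G      ≤⟨ *-monoˡ-≤ (suc M ^ G) U-bound ⟩
      M * T * suc M ^ G          ≡⟨ *-assoc M T _ ⟩
      M * (T * suc M ^ G)        ≤⟨ *-monoʳ-≤ M (∑-miss M R M≡ 1≤q G gs uniq szs G≤) ⟩
      M * (M ^ G * q ^ N)        ≡⟨ *-assoc M (M ^ G) (q ^ N) ⟨
      M ^ suc G * q ^ N          ∎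
      where
      open ≤-Reasoning
      hs = vecs (allFin q) N
      T = ∑ hs (miss gs)
      U = ∑ hs (miss (g ∷ gs))
      W = ∑ hs (λ h → miss gs h * match (X g) v h)
      split : U + W ≡ T
      split = trans (sym (∑-+ hs _ _)) (∑-cong hs λ h →
        trans (sym (*-distribˡ-+ (miss gs h) (1 ∸ match (X g) v h) (match (X g) v h)))
              (trans (cong (miss gs h *_) (m∸n+n≡m (match≤1 (X g) v h))) (*-identityʳ _)))
      W-bound : T ≤ W * suc M
      W-bound = begin
        T                    ≡⟨ ∑-match (X g) v (miss gs) (miss-independent g gs g∉) ⟨
        W * q ^ size (X g)   ≤⟨ *-monoʳ-≤ W (^-monoʳ-≤ q {{>-nonZero 1≤q}} sz) ⟩
        W * q ^ R            ≤⟨ *-monoʳ-≤ W M≡ ⟩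
        W * suc M            ∎
      -- This is `(U + W) * suc M ≡ T * suc M` minus `T ≤ W * suc M`; adding `T` to both sides
      -- avoids truncated subtraction.
      U-bound : U * suc M ≤ M * T
      U-bound = +-cancelʳ-≤ T _ _ (begin
        U * suc M + T            ≤⟨ +-monoʳ-≤ (U * suc M) W-bound ⟩
        U * suc M + W * suc M    ≡⟨ *-distribʳ-+ (suc M) U W ⟨
        (U + W) * suc M          ≡⟨ cong (_* suc M) split ⟩
        T * suc M                ≡⟨ *-comm T (suc M) ⟩
        T + M * T                ≡⟨ +-comm T (M * T) ⟩
        M * T + T                ∎)

-- The union bound over labellings and column values.

module RandomTables where

  open FiniteSums
  open IndependentCells
  open import Data.Nat
  open import Data.Nat.Properties
  open import Data.Fin using (combine; remQuot)
  import Data.Fin.Properties as Fin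
  open import Data.List using (map; cartesianProduct)
  open import Data.List.Membership.Propositional.Properties using (∈-allFin; ∈-map⁺; ∈-cartesianProduct⁺; ∈-cartesianProduct⁻; ∈-filter⁻)
  open import Data.List.Relation.Unary.Any using (here; there)
  open import Data.List.Relation.Unary.All using (All)
  import Data.List.Relation.Unary.All as All
  import Data.List.Relation.Unary.Unique.Propositional.Properties as Unique
  open import Data.Maybe.Properties using (just-injective; ≡-dec)
  open import Data.Vec using (Vec; lookup)
  open import Relation.Nullary.Decidable using (_×-dec_; dec-true)

  private variable
    A B : Set

  length-∑ : (xs : List A) → length xs ≡ ∑ xs (λ _ → 1)
  length-∑ xs = sym (trans (∑-const xs 1) (*-identityʳ _))

  length-cartesianProduct : (xs : List A) (ys : List B) →
                            length (cartesianProduct xs ys) ≡ length xs * length ys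
  length-cartesianProduct xs ys = begin
    length (cartesianProduct xs ys)      ≡⟨ length-∑ (cartesianProduct xs ys) ⟩
    ∑ (cartesianProduct xs ys) (λ _ → 1) ≡⟨ ∑-cartesianProductWith _,_ xs ys (λ _ → 1) ⟩
    ∑ xs (λ _ → ∑ ys (λ _ → 1))          ≡⟨ ∑-const xs _ ⟩
    length xs * ∑ ys (λ _ → 1)           ≡⟨ cong (length xs *_) (length-∑ ys) ⟨
    length xs * length ys                ∎
    where open ≡-Reasoning

  infix 4 _≟ₗ_
  _≟ₗ_ : ∀ {t} (x y : Maybe (Fin t)) → Dec (x ≡ y)
  _≟ₗ_ = ≡-dec Fin._≟_

  classSize : ∀ {n t} → (Fin n → Maybe (Fin t)) → Fin t → ℕ
  classSize {n} α i = ∑ (allFin n) λ a → 𝟙 (α a ≟ₗ just i)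

  module _ {n t : ℕ} (r : ℕ) where
    -- `α` and `β` record which branch set each vertex of the two sides belongs to. A small label is
    -- absent from the second side and has at most `r` vertices, possibly none, on the first;
    -- swapping the arguments swaps the sides.
    Small : (α β : Fin n → Maybe (Fin t)) → Fin t → Set
    Small α β i = classSize β i ≡ 0 × classSize α i ≤ r

    small? : ∀ α β → Decidable (Small α β)
    small? α β i = (classSize β i ≟ 0) ×-dec (classSize α i ≤? r)

    smalls : (α β : Fin n → Maybe (Fin t)) → List (Fin t)
    smalls α β = filter (small? α β) (allFin t)

  inBlock : ∀ {n t} (α β : Fin n → Maybe (Fin t)) → Fin t × Fin t → Fin n × Fin n → Bool
  inBlock α β (i , j) (a , b) = does (α a ≟ₗ just i) ∧ does (β b ≟ₗ just j)

  block : ∀ {n t} (α β : Fin n → Maybe (Fin t)) → Fin t × Fin t → Fin (n * n) → Bool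
  block {n} α β g k = inBlock α β g (remQuot n k)

  does-true : {P : Set} (P? : Dec P) → does P? ≡ true → P
  does-true (yes p) _ = p

  ∧-true : ∀ a b → a ∧ b ≡ true → a ≡ true × b ≡ true
  ∧-true true true refl = refl , refl

  block-disjoint : ∀ {n t} (α β : Fin n → Maybe (Fin t)) {g g′ : Fin t × Fin t} (k : Fin (n * n)) →
                   block α β g k ≡ true → block α β g′ k ≡ true → g ≡ g′
  block-disjoint {n} α β {i , j} {i′ , j′} k e e′ =
    let (a , b)   = remQuot n k
        (p , p₂)  = ∧-true _ _ e
        (p′ , p₂′) = ∧-true _ _ e′
    in cong₂ _,_ (just-injective (trans (sym (does-true (α a ≟ₗ just i) p)) (does-true (α a ≟ₗ just i′) p′)))
                 (just-injective (trans (sym (does-true (β b ≟ₗ just j) p₂)) (does-true (β b ≟ₗ just j′) p₂′)))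

  block-size : ∀ {n t} (α β : Fin n → Maybe (Fin t)) (i j : Fin t) →
               size (block α β (i , j)) ≡ classSize α i * classSize β j
  block-size {n} {t} α β i j = begin
    ∑ (allFin (n * n)) (bit ∘ block α β (i , j))
      ≡⟨ ∑-allFin-combine n n _ ⟩
    ∑ (allFin n) (λ a → ∑ (allFin n) (λ b → bit (block α β (i , j) (combine a b))))
      ≡⟨ ∑-cong (allFin n) (λ a → trans (∑-cong (allFin n) (λ b → cell a b)) (∑-*ˡ (allFin n) _ (𝟙 (α a ≟ₗ just i)))) ⟩
    ∑ (allFin n) (λ a → 𝟙 (α a ≟ₗ just i) * classSize β j)
      ≡⟨ ∑-*ʳ (allFin n) _ (classSize β j) ⟩
    classSize α i * classSize β j ∎
    where
    open ≡-Reasoning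
    bit-∧ : ∀ x y → bit (x ∧ y) ≡ bit x * bit y
    bit-∧ true  y = sym (*-identityˡ _)
    bit-∧ false y = refl
    cell : ∀ a b → bit (block α β (i , j) (combine a b)) ≡ 𝟙 (α a ≟ₗ just i) * 𝟙 (β b ≟ₗ just j)
    cell a b = trans (cong (bit ∘ inBlock α β (i , j)) (Fin.remQuot-combine {n} {n} a b)) (bit-∧ (does (α a ≟ₗ just i)) (does (β b ≟ₗ just j)))

  module _ (n t q r s M : ℕ) (1≤q : 1 ≤ q) (q^≤ : q ^ (r * r) ≤ suc M)
           (few : suc t ^ n * (suc t ^ n * q ^ n) * M ^ (s * s) < suc M ^ (s * s)) where

    private
      labels : List (Maybe (Fin t))
      labels = nothing ∷ map just (allFin t)

      ∈-labels : ∀ x → x ∈ labels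
      ∈-labels nothing  = here refl
      ∈-labels (just i) = there (∈-map⁺ just (∈-allFin i))

      Structure : Set
      Structure = Vec (Maybe (Fin t)) n × Vec (Maybe (Fin t)) n × Vec (Fin q) n

      structures : List Structure
      structures = cartesianProduct (vecs labels n) (cartesianProduct (vecs labels n) (vecs (allFin q) n))

      ∈-structures : ∀ σ → σ ∈ structures
      ∈-structures (α , β , c) = ∈-cartesianProduct⁺ (∈-vecs ∈-labels α)
        (∈-cartesianProduct⁺ (∈-vecs ∈-labels β) (∈-vecs ∈-allFin c))

      ∑-labels : ∑ labels (λ _ → 1) ≡ suc t
      ∑-labels = cong suc (trans (∑-map just (allFin t) (λ _ → 1)) (∑-allFin-1 t))

      ∑-structures : ∑ structures (λ _ → 1) ≡ suc t ^ n * (suc t ^ n * q ^ n)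
      ∑-structures = begin
        ∑ structures (λ _ → 1)                             ≡⟨ length-∑ structures ⟨
        length structures                                  ≡⟨ length-cartesianProduct ls _ ⟩
        length ls * length (cartesianProduct ls qs)        ≡⟨ cong (length ls *_) (length-cartesianProduct ls qs) ⟩
        length ls * (length ls * length qs)                ≡⟨ cong₂ (λ a b → a * (a * b)) len-ls len-qs ⟩
        suc t ^ n * (suc t ^ n * q ^ n)                    ∎
        where
        open ≡-Reasoning
        ls = vecs labels n
        qs = vecs (allFin q) n
        len-ls : length ls ≡ suc t ^ n
        len-ls = trans (length-∑ ls) (trans (∑-vecs-1 labels n) (cong (_^ n) ∑-labels))
        len-qs : length qs ≡ q ^ n
        len-qs = trans (length-∑ qs) (trans (∑-vecs-1 (allFin q) n) (cong (_^ n) (∑-allFin-1 q)))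

      groups : Structure → List (Fin t × Fin t)
      groups (α , β , c) = cartesianProduct (smalls r (lookup α) (lookup β)) (smalls r (lookup β) (lookup α))

      hs : List (Vec (Fin q) (n * n))
      hs = vecs (allFin q) (n * n)

      missed : Structure → Vec (Fin q) (n * n) → ℕ
      missed (α , β , c) = miss (block (lookup α) (lookup β)) (λ k → lookup c (proj₂ (remQuot {n} n k)))
                                (block-disjoint (lookup α) (lookup β)) (groups (α , β , c))

      -- The decision is an argument so that `∑-badIf` can split on it. A structure with fewer than
      -- `s * s` candidate pairs promises nothing, so no table counts as bad for it.
      badIf : ∀ {P : Set} → Dec P → Structure → Vec (Fin q) (n * n) → ℕ
      badIf d σ h = if does d then missed σ h else 0

      bad : Structure → Vec (Fin q) (n * n) → ℕ
      bad σ = badIf (s * s ≤? length (groups σ)) σ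

      groups-size : (σ : Structure) → let (α , β , _) = σ in
                    All (λ g → size (block (lookup α) (lookup β) g) ≤ r * r) (groups σ)
      groups-size (α , β , c) = All.tabulate λ {(i , j)} ij∈ →
        let (i∈ , j∈) = ∈-cartesianProduct⁻ (smalls r (lookup α) (lookup β)) (smalls r (lookup β) (lookup α)) ij∈
        in subst (_≤ r * r) (sym (block-size (lookup α) (lookup β) i j))
             (*-mono-≤ (proj₂ (proj₂ (∈-filter⁻ (small? r (lookup α) (lookup β)) {xs = allFin t} i∈)))
                       (proj₂ (proj₂ (∈-filter⁻ (small? r (lookup β) (lookup α)) {xs = allFin t} j∈))))

      groups-unique : ∀ σ → Unique (groups σ)
      groups-unique (α , β , c) = Unique.cartesianProduct⁺ (smalls-unique (lookup α) (lookup β))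
                                                          (smalls-unique (lookup β) (lookup α))
        where
        smalls-unique : ∀ α β → Unique (smalls r α β)
        smalls-unique α β = Unique.filter⁺ (small? r α β) (Unique.allFin⁺ t)

      ∑-badIf : ∀ σ (d : Dec (s * s ≤ length (groups σ))) →
                ∑ hs (badIf d σ) * suc M ^ (s * s) ≤ M ^ (s * s) * q ^ (n * n)
      ∑-badIf (α , β , c) (yes len) =
        ∑-miss (block (lookup α) (lookup β)) _ (block-disjoint (lookup α) (lookup β))
               M (r * r) q^≤ 1≤q (s * s) (groups (α , β , c)) (groups-unique (α , β , c)) (groups-size (α , β , c)) len
      ∑-badIf σ (no _) = subst (λ z → z * suc M ^ (s * s) ≤ M ^ (s * s) * q ^ (n * n)) (sym (∑-0 hs)) z≤n

      ∑-bad : ∀ σ → ∑ hs (bad σ) * suc M ^ (s * s) ≤ M ^ (s * s) * q ^ (n * n)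
      ∑-bad σ = ∑-badIf σ (s * s ≤? length (groups σ))

      -- Double counting of pairs of a table and a structure for which it is bad. By `few`, the
      -- number of structures times `(M / suc M) ^ (s * s)` is below 1.
      total-bad : ∑ hs (λ h → ∑ structures (λ σ → bad σ h)) < ∑ hs (λ _ → 1)
      total-bad = *-cancelʳ-< (suc M ^ (s * s)) _ _ (begin-strict
        ∑ hs (λ h → ∑ structures (λ σ → bad σ h)) * suc M ^ (s * s)
          ≡⟨ cong (_* suc M ^ (s * s)) (∑-comm hs structures (λ h σ → bad σ h)) ⟩
        ∑ structures (λ σ → ∑ hs (bad σ)) * suc M ^ (s * s)
          ≡⟨ ∑-*ʳ structures (λ σ → ∑ hs (bad σ)) (suc M ^ (s * s)) ⟨
        ∑ structures (λ σ → ∑ hs (bad σ) * suc M ^ (s * s))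
          ≤⟨ ∑-mono structures (λ σ → ≤-trans (∑-bad σ) (≤-reflexive (sym (*-identityˡ _)))) ⟩
        ∑ structures (λ σ → 1 * (M ^ (s * s) * q ^ (n * n)))
          ≡⟨ ∑-*ʳ structures (λ _ → 1) (M ^ (s * s) * q ^ (n * n)) ⟩
        ∑ structures (λ _ → 1) * (M ^ (s * s) * q ^ (n * n))
          ≡⟨ cong (_* (M ^ (s * s) * q ^ (n * n))) ∑-structures ⟩
        suc t ^ n * (suc t ^ n * q ^ n) * (M ^ (s * s) * q ^ (n * n))
          ≡⟨ *-assoc (suc t ^ n * (suc t ^ n * q ^ n)) (M ^ (s * s)) (q ^ (n * n)) ⟨
        suc t ^ n * (suc t ^ n * q ^ n) * M ^ (s * s) * q ^ (n * n)
          <⟨ *-monoˡ-< (q ^ (n * n)) {{m^n≢0 q (n * n) {{>-nonZero 1≤q}}}} few ⟩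
        suc M ^ (s * s) * q ^ (n * n)
          ≡⟨ *-comm (suc M ^ (s * s)) (q ^ (n * n)) ⟩
        q ^ (n * n) * suc M ^ (s * s)
          ≡⟨ cong (λ z → z ^ (n * n) * suc M ^ (s * s)) (∑-allFin-1 q) ⟨
        ∑ (allFin q) (λ _ → 1) ^ (n * n) * suc M ^ (s * s)
          ≡⟨ cong (_* suc M ^ (s * s)) (∑-vecs-1 (allFin q) (n * n)) ⟨
        ∑ hs (λ _ → 1) * suc M ^ (s * s) ∎)
        where open ≤-Reasoning

    random-table : Σ (Fin n → Fin n → Fin q) λ h →
      ∀ (α β : Vec (Maybe (Fin t)) n) (c : Vec (Fin q) n) →
      s ≤ length (smalls r (lookup α) (lookup β)) → s ≤ length (smalls r (lookup β) (lookup α)) →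
      ∃[ i ] ∃[ j ] Small r (lookup α) (lookup β) i × Small r (lookup β) (lookup α) j ×
        (∀ a b → lookup α a ≡ just i → lookup β b ≡ just j → lookup c b ≡ h a b)
    -- For this `h` the number of bad structures is below 1, hence 0, so every structure with enough
    -- pairs has a block on which `h` agrees with `c`.
    random-table = let (h , lt) = ∑-< hs _ _ total-bad in (λ a b → lookup h (combine a b)) , λ α β c s≤ s≤′ →
      let σ = (α , β , c)
          len = subst (s * s ≤_) (sym (length-cartesianProduct (smalls r (lookup α) (lookup β)) _)) (*-mono-≤ s≤ s≤′)
          bad≡0 = ∑≡0⇒ structures (λ σ → bad σ h) (n<1⇒n≡0 lt) (∈-structures σ)
          missed≡0 = subst (λ b → (if b then missed σ h else 0) ≡ 0) (dec-true (s * s ≤? length (groups σ)) len) bad≡0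
          ((i , j) , ij∈ , hit) = miss≡0 (block (lookup α) (lookup β)) _ (block-disjoint (lookup α) (lookup β)) (groups σ) h missed≡0
          (i∈ , j∈) = ∈-cartesianProduct⁻ (smalls r (lookup α) (lookup β)) (smalls r (lookup β) (lookup α)) ij∈
      in i , j , proj₂ (∈-filter⁻ (small? r (lookup α) (lookup β)) {xs = allFin t} i∈)
               , proj₂ (∈-filter⁻ (small? r (lookup β) (lookup α)) {xs = allFin t} j∈)
               , λ a b αa βb → trans (cong (lookup c ∘ proj₂) (sym (Fin.remQuot-combine {n} {n} a b)))
                   (hit (combine a b) (trans (cong (inBlock (lookup α) (lookup β) (i , j)) (Fin.remQuot-combine {n} {n} a b))
                     (cong₂ _∧_ (dec-true (lookup α a ≟ₗ just i) αa) (dec-true (lookup β b ≟ₗ just j) βb))))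

-- Existence of scattered tables for all large `t`.

module ScatteredTables where

  open FiniteSums
  open RandomTables
  open import Data.Nat
  open import Data.Nat.Properties
  open import Data.Nat.DivMod using (m/n*n≤m; m≡m%n+[m/n]*n; m%n<n)
  open import Data.Nat.Tactic.RingSolver using (solve-∀)
  import Data.Fin.Properties as Fin
  open import Data.List.Membership.Propositional.Properties using (∈-allFin)
  open import Data.Vec using (lookup; tabulate)
  open import Data.Vec.Properties using (lookup∘tabulate)

  ∑-classSize : ∀ {n t} (α : Fin n → Maybe (Fin t)) → ∑ (allFin t) (classSize α) ≤ n
  ∑-classSize {n} {t} α = begin
    ∑ (allFin t) (classSize α)                                   ≡⟨ ∑-comm (allFin t) (allFin n) _ ⟩
    ∑ (allFin n) (λ a → ∑ (allFin t) (λ i → 𝟙 (α a ≟ₗ just i)))  ≤⟨ ∑-mono (allFin n) (λ a → one (α a)) ⟩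
    ∑ (allFin n) (λ _ → 1)                                       ≡⟨ ∑-allFin-1 n ⟩
    n                                                            ∎
    where
    open ≤-Reasoning
    one : ∀ x → ∑ (allFin t) (λ i → 𝟙 (x ≟ₗ just i)) ≤ 1
    one nothing  = ≤-trans (≤-reflexive (∑-0 (allFin t))) z≤n
    one (just v) = ≤-trans (∑-mono (allFin t) le) (≤-reflexive (∑-allFin-≟ v))
      where
      le : ∀ i → 𝟙 (just v ≟ₗ just i) ≤ 𝟙 (v Fin.≟ i)
      le i with v Fin.≟ i
      ... | yes _ = ≤-refl
      ... | no _  = z≤n

  -- At most n labels occur in β, and at most n/(r+1) ≤ y labels occur more than r times in α.
  length-smalls : ∀ {n t} r s y (α β : Fin n → Maybe (Fin t)) → n + (s + y) ≤ t → n ≤ suc r * y →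
                  s ≤ length (smalls r α β)
  length-smalls {n} {t} r s y α β t≥ n≤ =
    +-cancelʳ-≤ (n + y) s _ (begin
      s + (n + y)                       ≡⟨ rearrange s n y ⟩
      n + (s + y)                       ≤⟨ t≥ ⟩
      t                                 ≡⟨ ∑-allFin-1 t ⟨
      ∑ (allFin t) (λ _ → 1)            ≤⟨ ∑-mono (allFin t) pointwise ⟩
      ∑ (allFin t) (λ i → 𝟙 (small? r α β i) + (classSize β i + big i))
        ≡⟨ trans (∑-+ (allFin t) _ _) (cong (∑ (allFin t) (λ i → 𝟙 (small? r α β i)) +_) (∑-+ (allFin t) _ _)) ⟩
      ∑ (allFin t) (λ i → 𝟙 (small? r α β i)) + (∑ (allFin t) (classSize β) + ∑ (allFin t) big)
        ≤⟨ +-mono-≤ (≤-reflexive (sym (length-filter-∑ (small? r α β) (allFin t)))) (+-mono-≤ (∑-classSize β) few-big) ⟩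
      length (smalls r α β) + (n + y)   ∎)
    where
    open ≤-Reasoning
    big : Fin t → ℕ
    big i = 𝟙 (suc r ≤? classSize α i)
    rearrange : ∀ s n y → s + (n + y) ≡ n + (s + y)
    rearrange = solve-∀
    pointwise : ∀ i → 1 ≤ 𝟙 (small? r α β i) + (classSize β i + big i)
    pointwise i with classSize β i ≟ 0 | suc r ≤? classSize α i
    ... | no ≢0 | _       = ≤-trans (n≢0⇒n>0 ≢0) (≤-trans (m≤m+n (classSize β i) (big i)) (m≤n+m _ (𝟙 (small? r α β i))))
    ... | yes _ | yes p   = ≤-trans (≤-trans (≤-reflexive (sym (𝟙-yes (suc r ≤? classSize α i) p))) (m≤n+m (big i) (classSize β i)))
                                    (m≤n+m _ (𝟙 (small? r α β i)))
    ... | yes e | no ≰    = ≤-trans (≤-reflexive (sym (𝟙-yes (small? r α β i) (e , ≮⇒≥ ≰)))) (m≤m+n _ _)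
    *-𝟙-≤ : ∀ {k l} (d : Dec (k ≤ l)) → k * 𝟙 d ≤ l
    *-𝟙-≤ {k} (yes p) = ≤-trans (≤-reflexive (*-identityʳ k)) p
    *-𝟙-≤ {k} (no _)  = ≤-trans (≤-reflexive (*-zeroʳ k)) z≤n
    few-big : ∑ (allFin t) big ≤ y
    few-big = *-cancelˡ-≤ (suc r) (begin
      suc r * ∑ (allFin t) big            ≡⟨ ∑-*ˡ (allFin t) big (suc r) ⟨
      ∑ (allFin t) (λ i → suc r * big i)  ≤⟨ ∑-mono (allFin t) (λ i → *-𝟙-≤ (suc r ≤? classSize α i)) ⟩
      ∑ (allFin t) (classSize α)          ≤⟨ ∑-classSize α ⟩
      n                                   ≤⟨ n≤ ⟩
      suc r * y                           ∎)

  classSize≡0⇒ : ∀ {n t} (α : Fin n → Maybe (Fin t)) i → classSize α i ≡ 0 → ∀ a → α a ≢ just i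
  classSize≡0⇒ {n} α i eq a αa =
    contradiction (trans (sym (𝟙-yes (α a ≟ₗ just i) αa)) (∑≡0⇒ (allFin n) _ eq (∈-allFin a))) λ()

  -- Reading "h a b ≡ c b" as non-adjacency of a and b, this says that the bipartite graph has no
  -- pairwise adjacent family of t disjoint subsets.
  Scattered : (t n q : ℕ) → (Fin n → Fin n → Fin q) → Set
  Scattered t n q h = ∀ (α β : Fin n → Maybe (Fin t)) (c : Fin n → Fin q) →
    ∃[ i ] ∃[ j ] (∀ b → β b ≢ just i) × (∀ a → α a ≢ just j) ×
      (∀ a b → α a ≡ just i → β b ≡ just j → h a b ≡ c b)

  scattered : ∀ (n t q r s y M : ℕ) → 1 ≤ q → q ^ (r * r) ≤ suc M →
    suc t ^ n * (suc t ^ n * q ^ n) * M ^ (s * s) < suc M ^ (s * s) →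
    n + (s + y) ≤ t → n ≤ suc r * y → ∃ (Scattered t n q)
  scattered n t q r s y M 1≤q q^≤ few t≥ n≤ =
    let (h , prop) = random-table n t q r s M 1≤q q^≤ few in h , λ α β c →
    let α′ = lookup (tabulate α)
        β′ = lookup (tabulate β)
        (i , j , (βi≡0 , _) , (αj≡0 , _) , hit) =
          prop (tabulate α) (tabulate β) (tabulate c)
            (length-smalls r s y α′ β′ t≥ n≤) (length-smalls r s y β′ α′ t≥ n≤)
    in i , j
     , (λ b βb → classSize≡0⇒ β′ i βi≡0 b (trans (lookup∘tabulate β b) βb))
     , (λ a αa → classSize≡0⇒ α′ j αj≡0 a (trans (lookup∘tabulate α a) αa))
     , λ a b αa βb → trans (sym
         (hit a b (trans (lookup∘tabulate α a) αa) (trans (lookup∘tabulate β b) βb))) (lookup∘tabulate c b)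

  -- Exponential and logarithmic estimates in natural numbers.

  -- The left side consists of the first two terms of the binomial expansion of the right side.
  bernoulli : ∀ m e → m ^ suc e + suc e * m ^ e ≤ suc m ^ suc e
  bernoulli m zero    = ≤-reflexive (base m)
    where
    base : ∀ m → m * 1 + 1 * 1 ≡ suc m * 1
    base = solve-∀
  bernoulli m (suc e) = begin
    m * (m * p) + suc (suc e) * (m * p)                  ≤⟨ m≤m+n _ (suc e * p) ⟩
    m * (m * p) + suc (suc e) * (m * p) + suc e * p      ≡⟨ expand m e p ⟩
    suc m * (m * p + suc e * p)                          ≤⟨ *-monoʳ-≤ (suc m) (bernoulli m e) ⟩
    suc m * suc m ^ suc e                                ∎
    where
    open ≤-Reasoning
    p = m ^ e
    expand : ∀ m e p → m * (m * p) + suc (suc e) * (m * p) + suc e * p ≡ suc m * (m * p + suc e * p)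
    expand = solve-∀

  2*m^[1+m]≤[1+m]^[1+m] : ∀ m → 2 * m ^ suc m ≤ suc m ^ suc m
  2*m^[1+m]≤[1+m]^[1+m] m = begin
    2 * (m * m ^ m)               ≤⟨ m≤m+n _ (m ^ m) ⟩
    2 * (m * m ^ m) + m ^ m       ≡⟨ rearrange m (m ^ m) ⟩
    m * m ^ m + suc m * m ^ m     ≤⟨ bernoulli m m ⟩
    suc m ^ suc m                 ∎
    where
    open ≤-Reasoning
    rearrange : ∀ m p → 2 * (m * p) + p ≡ m * p + suc m * p
    rearrange = solve-∀

  -- Each block of `suc m` factors `m / (1 + m)` has product at most 1/2, and `e` has room for `k`
  -- blocks. This gives the exponential decay of the failure probability.
  2^k*m^e≤[1+m]^e : ∀ m k e → suc m * k ≤ e → 2 ^ k * m ^ e ≤ suc m ^ e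
  2^k*m^e≤[1+m]^e m zero    e _ = ≤-trans (≤-reflexive (*-identityˡ _)) (^-monoˡ-≤ e (n≤1+n m))
  2^k*m^e≤[1+m]^e m (suc k) e le = begin
    2 * 2 ^ k * m ^ e                           ≡⟨ cong (λ z → 2 * 2 ^ k * m ^ z) e≡ ⟩
    2 * 2 ^ k * m ^ (suc m + d)                 ≡⟨ cong (2 * 2 ^ k *_) (^-distribˡ-+-* m (suc m) d) ⟩
    2 * 2 ^ k * (m ^ suc m * m ^ d)             ≡⟨ rearrange (2 ^ k) (m ^ suc m) (m ^ d) ⟩
    2 * m ^ suc m * (2 ^ k * m ^ d)             ≤⟨ *-mono-≤ (2*m^[1+m]≤[1+m]^[1+m] m) (2^k*m^e≤[1+m]^e m k d le′) ⟩
    suc m ^ suc m * suc m ^ d                   ≡⟨ ^-distribˡ-+-* (suc m) (suc m) d ⟨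
    suc m ^ (suc m + d)                         ≡⟨ cong (suc m ^_) e≡ ⟨
    suc m ^ e                                   ∎
    where
    open ≤-Reasoning
    d = e ∸ suc m
    le″ : suc m + suc m * k ≤ e
    le″ = ≤-trans (≤-reflexive (sym (*-suc (suc m) k))) le
    e≡ : e ≡ suc m + d
    e≡ = sym (m+[n∸m]≡n (≤-trans (m≤m+n (suc m) _) le″))
    le′ : suc m * k ≤ d
    le′ = m+n≤o⇒n≤o∸m (suc m) le″
      where
      m+n≤o⇒n≤o∸m : ∀ m {n o} → m + n ≤ o → n ≤ o ∸ m
      m+n≤o⇒n≤o∸m m {n} {o} p = m+n≤o⇒m≤o∸n n (≤-trans (≤-reflexive (+-comm n m)) p)
    rearrange : ∀ a b c → 2 * a * (b * c) ≡ 2 * b * (a * c)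
    rearrange = solve-∀

  1+n≤2^n : ∀ n → suc n ≤ 2 ^ n
  1+n≤2^n zero    = ≤-refl
  1+n≤2^n (suc n) = begin
    suc (suc n)    ≤⟨ s≤s (m≤n+m (suc n) n) ⟩
    suc n + suc n  ≤⟨ +-mono-≤ (1+n≤2^n n) (≤-trans (1+n≤2^n n) (≤-reflexive (sym (+-identityʳ _)))) ⟩
    2 ^ suc n      ∎
    where open ≤-Reasoning

  module _ (C : ℕ) where
    private
      -- `2 ^ ℓ₀` is the square of `2 ^ (6 * C)`, so it is at least `(6C + 1)²`, while
      -- `C * (3 * ℓ₀ + 4)` is only `36C² + 4C`.
      ℓ₀ = 2 * (6 * C)

      -- The summand 4 is `3 + 1`: `logarithm-bound` returns `suc ℓ`, so `3 * suc ℓ + 1` has to be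
      -- covered.
      Large : ℕ → Set
      Large ℓ = C * (3 * ℓ + 4) ≤ 2 ^ ℓ

      large-ℓ₀ : Large ℓ₀
      large-ℓ₀ = begin
        C * (3 * (2 * (6 * C)) + 4)        ≤⟨ m≤m+n _ (2 * C) ⟩
        C * (3 * (2 * (6 * C)) + 4) + 2 * C ≡⟨ rearrange C ⟩
        6 * C * suc (6 * C)                ≤⟨ *-monoˡ-≤ (suc (6 * C)) (n≤1+n (6 * C)) ⟩
        suc (6 * C) * suc (6 * C)          ≤⟨ *-mono-≤ (1+n≤2^n (6 * C)) (1+n≤2^n (6 * C)) ⟩
        2 ^ (6 * C) * 2 ^ (6 * C)          ≡⟨ ^-distribˡ-+-* 2 (6 * C) (6 * C) ⟨
        2 ^ (6 * C + 6 * C)                ≡⟨ cong (λ z → 2 ^ (6 * C + z)) (+-identityʳ (6 * C)) ⟨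
        2 ^ ℓ₀                             ∎
        where
        open ≤-Reasoning
        rearrange : ∀ C → C * (3 * (2 * (6 * C)) + 4) + 2 * C ≡ 6 * C * suc (6 * C)
        rearrange = solve-∀

      large-suc : ∀ ℓ → Large ℓ → Large (suc ℓ)
      large-suc ℓ large = begin
        C * (3 * suc ℓ + 4)                         ≤⟨ m≤m+n _ (C * (3 * ℓ + 1)) ⟩
        C * (3 * suc ℓ + 4) + C * (3 * ℓ + 1)       ≡⟨ rearrange C ℓ ⟩
        2 * (C * (3 * ℓ + 4))                       ≤⟨ *-monoʳ-≤ 2 large ⟩
        2 ^ suc ℓ                                   ∎
        where
        open ≤-Reasoning
        rearrange : ∀ C ℓ → C * (3 * suc ℓ + 4) + C * (3 * ℓ + 1) ≡ 2 * (C * (3 * ℓ + 4))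
        rearrange = solve-∀

      -- `ℓ` is the integer part of the binary logarithm of `d + 2 ^ ℓ₀`. Counting up from `ℓ₀` lets
      -- `Large` be carried along by `large-suc` whenever `ℓ` grows.
      bracket : ∀ d → ∃[ ℓ ] Large ℓ × 2 ^ ℓ ≤ d + 2 ^ ℓ₀ × d + 2 ^ ℓ₀ < 2 ^ suc ℓ
      bracket zero = ℓ₀ , large-ℓ₀ , ≤-refl ,
        ≤-trans (+-monoˡ-≤ (2 ^ ℓ₀) (m^n>0 2 ℓ₀)) (≤-reflexive (cong (2 ^ ℓ₀ +_) (sym (+-identityʳ _))))
      bracket (suc d) with bracket d
      ... | ℓ , large , lo , hi with suc (d + 2 ^ ℓ₀) <? 2 ^ suc ℓ
      ...   | yes lt = ℓ , large , m≤n⇒m≤1+n lo , lt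
      ...   | no ≮   = suc ℓ , large-suc ℓ large , ≮⇒≥ ≮ ,
        ≤-<-trans hi (subst (2 ^ suc ℓ <_) (*-comm (2 ^ suc ℓ) 2) (m<m*n (2 ^ suc ℓ) 2 {{m^n≢0 2 (suc ℓ)}} (s≤s (s≤s z≤n))))

    logarithm-bound : ∃[ t₀ ] ∀ t → t₀ ≤ t → ∃[ ℓ ] suc t ≤ 2 ^ ℓ × C * (3 * ℓ + 1) ≤ t
    logarithm-bound = 2 ^ ℓ₀ , λ t t₀≤t →
      let (ℓ , large , lo , hi) = bracket (t ∸ 2 ^ ℓ₀)
          t≡ = m∸n+n≡m t₀≤t
      in suc ℓ , subst (_< 2 ^ suc ℓ) t≡ hi
       , subst (C * (3 * suc ℓ + 1) ≤_) t≡ (≤-trans (≤-reflexive (cong (C *_) (rearrange ℓ))) (≤-trans large lo))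
      where
      rearrange : ∀ ℓ → 3 * suc ℓ + 1 ≡ 3 * ℓ + 4
      rearrange = solve-∀

  -- Each of the three factors counting structures is at most `2 ^ (ℓ * t)`. The exponent `3ℓt` has
  -- order `t log t`, whereas `e` is at least `t² / D`.
  few-structures : ∀ t n q M e D ℓ → suc t ≤ 2 ^ ℓ → n ≤ t → q ≤ suc t → 1 ≤ t →
    D * suc M * (3 * ℓ + 1) ≤ t → t * t ≤ D * e → 1 ≤ D →
    suc t ^ n * (suc t ^ n * q ^ n) * M ^ e < suc M ^ e
  few-structures t n q M e D ℓ t≤ n≤t q≤ 1≤t large e≥ 1≤D = begin-strict
    suc t ^ n * (suc t ^ n * q ^ n) * M ^ e
      ≤⟨ *-monoˡ-≤ (M ^ e) (*-mono-≤ bound (*-mono-≤ bound (≤-trans (^-monoˡ-≤ n q≤) bound))) ⟩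
    P * (P * P) * M ^ e
      ≡⟨ cong (_* M ^ e) P³≡ ⟩
    2 ^ k * M ^ e
      <⟨ double-< (m^n>0 (suc M) e) (≤-trans (≤-reflexive (double (2 ^ k) (M ^ e))) (2^k*m^e≤[1+m]^e M (suc k) e sk≤e)) ⟩
    suc M ^ e
      ∎
    where
    open ≤-Reasoning
    k = 3 * (ℓ * t)
    P = 2 ^ (ℓ * t)
    bound : suc t ^ n ≤ P
    bound = begin
      suc t ^ n       ≤⟨ ^-monoʳ-≤ (suc t) n≤t ⟩
      suc t ^ t       ≤⟨ ^-monoˡ-≤ t t≤ ⟩
      (2 ^ ℓ) ^ t     ≡⟨ ^-*-assoc 2 ℓ t ⟩
      P               ∎
    P³≡ : P * (P * P) ≡ 2 ^ k
    P³≡ = trans (cong (P *_) (sym (^-distribˡ-+-* 2 (ℓ * t) (ℓ * t))))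
      (trans (sym (^-distribˡ-+-* 2 (ℓ * t) (ℓ * t + ℓ * t)))
        (cong (λ z → 2 ^ (ℓ * t + (ℓ * t + z))) (sym (+-identityʳ (ℓ * t)))))
    double : ∀ a b → a * b + a * b ≡ 2 * a * b
    double = solve-∀
    double-< : ∀ {x y} → 1 ≤ y → x + x ≤ y → x < y
    double-< {zero}  1≤y _  = 1≤y
    double-< {suc x} _   le = <-≤-trans (m<m+n (suc x) (s≤s z≤n)) le
    -- Room for `suc k` blocks instead of `k` gives a spare factor 2, which makes the final
    -- inequality strict.
    sk≤e : suc M * suc k ≤ e
    sk≤e = *-cancelˡ-≤ D {{>-nonZero 1≤D}} (begin
      D * (suc M * suc (3 * (ℓ * t)))     ≤⟨ *-monoʳ-≤ D (*-monoʳ-≤ (suc M) (+-mono-≤ 1≤t (≤-refl {3 * (ℓ * t)}))) ⟩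
      D * (suc M * (t + 3 * (ℓ * t)))     ≡⟨ rearrange D (suc M) ℓ t ⟩
      D * suc M * (3 * ℓ + 1) * t         ≤⟨ *-monoˡ-≤ t large ⟩
      t * t                               ≤⟨ e≥ ⟩
      D * e                               ∎)
      where
      rearrange : ∀ D M ℓ t → D * (M * (t + 3 * (ℓ * t))) ≡ D * M * (3 * ℓ + 1) * t
      rearrange = solve-∀

  scattered-tables : ∀ K → 1 ≤ K → ∃[ t₀ ] ∀ t → t₀ ≤ t →
    ∃[ n ] ∃[ u ] n + (u + u) ≡ t × 8 * K * u ≤ t × 1 ≤ u × ∃ (Scattered t n (2 * K))
  scattered-tables K@(suc K-1) 1≤K = t₁ + 8 * K , λ t t≥ →
    let (ℓ , t< , large) = log t (≤-trans (m≤m+n t₁ _) t≥)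
    in tables t ℓ (≤-trans (m≤n+m (8 * K) t₁) t≥) t< large
    where
    open ≤-Reasoning
    -- With `K` the denominator of `ε`, the value `2 * K` makes the list deletions cost at most
    -- `t / (2K)`, half of the permitted loss `t / K`.
    q = 2 * K
    -- From `n ≤ t ≤ 16 * K * u` and `suc r = 16 * K`, at most `u` labels have more than `r`
    -- vertices on a side, leaving `u` small ones.
    r = pred (16 * K)
    M = pred (q ^ (r * r))
    D = 16 * K * (16 * K)
    t₁ = proj₁ (logarithm-bound (D * suc M))
    log = proj₂ (logarithm-bound (D * suc M))
    tables : ∀ t ℓ → 8 * K ≤ t → suc t ≤ 2 ^ ℓ → D * suc M * (3 * ℓ + 1) ≤ t →
      ∃[ n ] ∃[ u ] n + (u + u) ≡ t × 8 * K * u ≤ t × 1 ≤ u × ∃ (Scattered t n q)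
    tables t ℓ 8K≤t t< large =
      n , u , n+2u≡t , 8Ku≤t , 1≤u ,
      scattered n t q r u u M (s≤s z≤n) (≤-reflexive (sym (suc-pred (q ^ (r * r)) {{m^n≢0 q (r * r)}})))
        (few-structures t n q M (u * u) D ℓ t< n≤t (≤-trans (≤-trans (*-monoˡ-≤ K (s≤s (s≤s (z≤n {6})))) 8K≤t) (n≤1+n t))
          (≤-trans (s≤s z≤n) 8K≤t) large t²≤ (s≤s z≤n))
        (≤-reflexive n+2u≡t) (≤-trans n≤t (≤-trans t≤16Ku (≤-reflexive (cong (_* u) (sym (suc-pred (16 * K)))))))
      where
      -- `8 * K * u ≤ t` keeps the loss `4u` within `t / (2K)`, the other half. Since `8 * K ≤ t`
      -- forces `1 ≤ u`, rounding down still leaves `t ≤ 16 * K * u`, so `u * u` is of order `t²`.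
      u = t / (8 * K)
      n = t ∸ (u + u)
      8Ku≤t : 8 * K * u ≤ t
      8Ku≤t = ≤-trans (≤-reflexive (*-comm (8 * K) u)) (m/n*n≤m t (8 * K))
      t<8K+8Ku : t < 8 * K + 8 * K * u
      t<8K+8Ku = begin-strict
        t                                 ≡⟨ m≡m%n+[m/n]*n t (8 * K) ⟩
        t % (8 * K) + u * (8 * K)         <⟨ +-monoˡ-< (u * (8 * K)) (m%n<n t (8 * K)) ⟩
        8 * K + u * (8 * K)               ≡⟨ cong (8 * K +_) (*-comm u (8 * K)) ⟩
        8 * K + 8 * K * u                 ∎
      1≤u : 1 ≤ u
      1≤u with u in eq
      ... | suc _ = s≤s z≤n
      ... | zero  = contradiction (≤-<-trans 8K≤t (subst (t <_) (trans (cong (λ z → 8 * K + 8 * K * z) eq) (trans (cong (8 * K +_) (*-zeroʳ (8 * K))) (+-identityʳ _))) t<8K+8Ku)) (<-irrefl refl)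
      t≤16Ku : t ≤ 16 * K * u
      t≤16Ku = begin
        t                             ≤⟨ <⇒≤ t<8K+8Ku ⟩
        8 * K + 8 * K * u             ≡⟨ cong (_+ 8 * K * u) (*-identityʳ (8 * K)) ⟨
        8 * K * 1 + 8 * K * u         ≤⟨ +-monoˡ-≤ (8 * K * u) (*-monoʳ-≤ (8 * K) 1≤u) ⟩
        8 * K * u + 8 * K * u         ≡⟨ double K u ⟩
        16 * K * u                    ∎
        where
        double : ∀ K u → 8 * K * u + 8 * K * u ≡ 16 * K * u
        double = solve-∀
      n≤t : n ≤ t
      n≤t = m∸n≤m t (u + u)
      n+2u≡t : n + (u + u) ≡ t
      n+2u≡t = m∸n+n≡m (begin
        u + u         ≡⟨ cong (u +_) (+-identityʳ u) ⟨
        2 * u         ≤⟨ *-monoˡ-≤ u (s≤s (s≤s (z≤n {6}))) ⟩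
        8 * u         ≡⟨ cong (_* u) (*-identityʳ 8) ⟨
        8 * 1 * u     ≤⟨ *-monoˡ-≤ u (*-monoʳ-≤ 8 1≤K) ⟩
        8 * K * u     ≤⟨ 8Ku≤t ⟩
        t             ∎)
      t²≤ : t * t ≤ D * (u * u)
      t²≤ = ≤-trans (*-mono-≤ t≤16Ku t≤16Ku) (≤-reflexive (square (16 * K) u))
        where
        square : ∀ a u → a * u * (a * u) ≡ a * a * (u * u)
        square = solve-∀

-- The glued graph: no large clique minor, and lists without a colouring.

module CliqueGluing where

  open FiniteSums
  open RandomTables using (_≟ₗ_)
  open ScatteredTables
  open import Data.Nat hiding (_≟_)
  open import Data.Nat.Properties hiding (_≟_)
  open import Data.Fin using (toℕ; combine; remQuot; splitAt; join; _↑ˡ_; _↑ʳ_; finToFun; funToFin)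
  open import Data.Fin.Properties using (_≟_; all?; any?; ¬∀⟶∃¬; injective⇒≤; toℕ-injective; splitAt-↑ˡ; splitAt-↑ʳ; splitAt⁻¹-↑ˡ; splitAt⁻¹-↑ʳ; remQuot-combine; combine-remQuot; join-splitAt; finToFun-funToFin)
  open import Data.List using (map)
  open import Data.List.Properties using (length-map; length-tabulate)
  open import Data.List.Membership.Propositional.Properties using (∈-allFin; ∈-map⁻; ∈-filter⁻)
  import Data.List.Relation.Unary.Unique.Propositional.Properties as Unique
  open import Data.Maybe.Properties using (just-injective)
  open import Relation.Nullary.Decidable using (_→-dec_; ¬?; _×-dec_)

  -- Pigeonhole over the `q` values. Applied to each column of the table, it bounds the
  -- non-neighbours of every `b` with certainty.
  rare-value : ∀ {n q m} (f : Fin n → Fin q) → n < q * suc m →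
               ∃[ y ] ∑ (allFin n) (λ a → 𝟙 (f a ≟ y)) ≤ m
  rare-value {n} {q} {m} f lt =
    let (y , le) = ∑-< (allFin q) (λ y → ∑ (allFin n) (λ a → 𝟙 (f a ≟ y))) (λ _ → suc m) (begin-strict
          ∑ (allFin q) (λ y → ∑ (allFin n) (λ a → 𝟙 (f a ≟ y)))  ≡⟨ ∑-comm (allFin q) (allFin n) _ ⟩
          ∑ (allFin n) (λ a → ∑ (allFin q) (λ y → 𝟙 (f a ≟ y)))  ≡⟨ ∑-cong (allFin n) (λ a → ∑-allFin-≟ (f a)) ⟩
          ∑ (allFin n) (λ _ → 1)                                 ≡⟨ ∑-allFin-1 n ⟩
          n                                                      <⟨ lt ⟩
          q * suc m                                              ≡⟨ cong (_* suc m) (length-tabulate {n = q} id) ⟨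
          length (allFin q) * suc m                              ≡⟨ ∑-const (allFin q) (suc m) ⟨
          ∑ (allFin q) (λ _ → suc m)                             ∎)
    in y , ≤-pred le
    where open ≤-Reasoning

  -- The clique A = Fin n with one copy of the clique B = Fin n for each colouring (encoded by Fin (P ^ n))
  -- of A with P colours; a ∈ A and b in a copy of B are non-adjacent iff h a b ≡ c b.
  module Gluing {n q : ℕ} (h : Fin n → Fin n → Fin q) (c : Fin n → Fin q) (P : ℕ) where

    Vertex : Set
    Vertex = Fin n ⊎ (Fin (P ^ n) × Fin n)

    order : ℕ
    order = n + P ^ n * n

    encode : Vertex → Fin order
    encode (inj₁ a)       = a ↑ˡ (P ^ n * n)
    encode (inj₂ (γ , b)) = n ↑ʳ combine γ b

    decode′ : Fin n ⊎ Fin (P ^ n * n) → Vertex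
    decode′ (inj₁ a) = inj₁ a
    decode′ (inj₂ k) = inj₂ (remQuot n k)

    decode : Fin order → Vertex
    decode v = decode′ (splitAt n v)

    decode-encode : ∀ x → decode (encode x) ≡ x
    decode-encode (inj₁ a)       = cong decode′ (splitAt-↑ˡ n a (P ^ n * n))
    decode-encode (inj₂ (γ , b)) = trans (cong decode′ (splitAt-↑ʳ n (P ^ n * n) (combine γ b)))
                                         (cong inj₂ (remQuot-combine γ b))

    encode-decode : ∀ v → encode (decode v) ≡ v
    encode-decode v with splitAt n v in eq
    ... | inj₁ a = splitAt⁻¹-↑ˡ eq
    ... | inj₂ k = trans (cong (n ↑ʳ_) (combine-remQuot {P ^ n} n k)) (splitAt⁻¹-↑ʳ eq)

    Adjacent : Vertex → Vertex → Set
    Adjacent (inj₁ a)       (inj₁ a′)        = a ≢ a′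
    Adjacent (inj₁ a)       (inj₂ (γ , b))   = h a b ≢ c b
    Adjacent (inj₂ (γ , b)) (inj₁ a)         = h a b ≢ c b
    Adjacent (inj₂ (γ , b)) (inj₂ (γ′ , b′)) = γ ≡ γ′ × b ≢ b′

    adjacent? : ∀ x y → Dec (Adjacent x y)
    adjacent? (inj₁ a)       (inj₁ a′)        = ¬? (a ≟ a′)
    adjacent? (inj₁ a)       (inj₂ (γ , b))   = ¬? (h a b ≟ c b)
    adjacent? (inj₂ (γ , b)) (inj₁ a)         = ¬? (h a b ≟ c b)
    adjacent? (inj₂ (γ , b)) (inj₂ (γ′ , b′)) = (γ ≟ γ′) ×-dec ¬? (b ≟ b′)

    adjacent-sym : ∀ x y → Adjacent x y → Adjacent y x
    adjacent-sym (inj₁ a) (inj₁ a′) a≢ = a≢ ∘ sym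
    adjacent-sym (inj₁ a) (inj₂ _)  ne = ne
    adjacent-sym (inj₂ _) (inj₁ a)  ne = ne
    adjacent-sym (inj₂ _) (inj₂ _)  (γ≡ , b≢) = sym γ≡ , b≢ ∘ sym

    adjacent-irrefl : ∀ x → ¬ Adjacent x x
    adjacent-irrefl (inj₁ a) a≢a       = a≢a refl
    adjacent-irrefl (inj₂ _) (_ , b≢b) = b≢b refl

    graph : Graph
    graph = record
      { n      = order
      ; Adj    = λ u v → Adjacent (decode u) (decode v)
      ; sym    = λ {u} {v} → adjacent-sym (decode u) (decode v)
      ; irrefl = λ {u} → adjacent-irrefl (decode u)
      }

    -- As `n < t`, some branch set avoids `A`; being connected, it lies in a single copy. Any other
    -- branch set avoiding `A` must touch it, so it lies in the same copy. `Scattered` is then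
    -- applied to the traces on `A` and this copy.
    no-minor : ∀ {t} → n < t → Scattered t n q h → ¬ HasKMinor graph t
    no-minor {t} n<t scattered-h (Z , nonempty , connected , edge) = contradiction-from (decode v₀) refl
      where
      ζ : Vertex → Maybe (Fin t)
      ζ = Z ∘ encode

      ζ-decode : ∀ {v i} → Z v ≡ just i → ζ (decode v) ≡ just i
      ζ-decode {v} = trans (cong Z (encode-decode v))

      AvoidsA : Fin t → Set
      AvoidsA i = ∀ a → ζ (inj₁ a) ≢ just i

      meetsA? : ∀ i → Dec (∃[ a ] ζ (inj₁ a) ≡ just i)
      meetsA? i = any? (λ a → ζ (inj₁ a) ≟ₗ just i)

      ¬all-meetA : ¬ (∀ i → ∃[ a ] ζ (inj₁ a) ≡ just i)
      ¬all-meetA meets = <⇒≱ n<t (injective⇒≤ {f = proj₁ ∘ meets} λ {i} {j} eq → just-injective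
        (trans (sym (proj₂ (meets i))) (trans (cong (ζ ∘ inj₁) eq) (proj₂ (meets j)))))

      some-avoidsA : ∃[ i ] AvoidsA i
      some-avoidsA = let (i , ¬meets) = ¬∀⟶∃¬ t _ meetsA? ¬all-meetA in i , λ a e → ¬meets (a , e)

      i₀ = proj₁ some-avoidsA
      v₀ = proj₁ (nonempty i₀)

      InCopy : Fin (P ^ n) → Vertex → Set
      InCopy γ x = ∃[ b ] x ≡ inj₂ (γ , b)

      neighbour-in-copy : ∀ {γ} x y → InCopy γ x → Adjacent x y → (∀ a → y ≢ inj₁ a) → InCopy γ y
      neighbour-in-copy _ (inj₁ a)       _          _            y∉A = contradiction refl (y∉A a)
      neighbour-in-copy _ (inj₂ (_ , b)) (_ , refl) (refl , _)   _   = b , refl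

      ∉A : ∀ {j} → AvoidsA j → ∀ {v} → Z v ≡ just j → ∀ a → decode v ≢ inj₁ a
      ∉A avoids {v} Zv a eq = avoids a (subst (λ x → ζ x ≡ just _) eq (ζ-decode {v} Zv))

      start : ∀ {R u v} → WalkIn graph R u v → R u
      start (here p)     = p
      start (step p _ _) = p

      walk-in-copy : ∀ {γ j} → AvoidsA j → ∀ {u v} → WalkIn graph (λ w → Z w ≡ just j) u v →
                     InCopy γ (decode u) → InCopy γ (decode v)
      walk-in-copy avoids (here _)                       u∈ = u∈
      walk-in-copy avoids (step {u} {w} _ adj walk) u∈ =
        walk-in-copy avoids walk (neighbour-in-copy (decode u) (decode w) u∈ adj (∉A avoids {w} (start walk)))

      contradiction-from : ∀ x → decode v₀ ≢ x
      contradiction-from (inj₁ a)        eq = ∉A (proj₂ some-avoidsA) {v₀} (proj₂ (nonempty i₀)) a eq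
      contradiction-from (inj₂ (γ , b₀)) eq =
        -- Branch set `i` may extend into other copies, but `j` lies wholly in copy `γ`, so an edge
        -- between them would have its other end in `A`, where `apart` forbids it.
        let (i , j , i∌B , j∌A , apart) = scattered-h (ζ ∘ inj₁) (λ b → ζ (inj₂ (γ , b))) c
            -- `Scattered` permits `i ≡ j`, namely a label on neither side. This is excluded because
            -- branch set `j` does meet the copy and `i` does not.
            (bⱼ , ζbⱼ) = meets-copy j j∌A
            i≢j = λ i≡j → i∌B bⱼ (trans ζbⱼ (cong just (sym i≡j)))
            (u , v , Zu , Zv , adj) = edge i j i≢j
            v∈copy = walk-in-copy j∌A (connected j (encode (inj₂ (γ , bⱼ))) v ζbⱼ Zv) (bⱼ , decode-encode (inj₂ (γ , bⱼ)))
        in apart-edge i j i∌B apart (decode u) (decode v) (ζ-decode {u} Zu) (ζ-decode {v} Zv) v∈copy adj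
        where
        copy : Fin n → Maybe (Fin t)
        copy b = ζ (inj₂ (γ , b))

        meets-copy : ∀ j → AvoidsA j → ∃[ b ] copy b ≡ just j
        meets-copy j avoids with i₀ ≟ j
        ... | yes refl = b₀ , subst (λ x → ζ x ≡ just i₀) eq (ζ-decode {v₀} (proj₂ (nonempty i₀)))
        ... | no i₀≢j =
          let (u , v , Zu , Zv , adj) = edge i₀ j i₀≢j
              u∈copy = walk-in-copy (proj₂ some-avoidsA) (connected i₀ v₀ u (proj₂ (nonempty i₀)) Zu) (b₀ , eq)
              (b , v≡) = neighbour-in-copy (decode u) (decode v) u∈copy adj (∉A avoids {v} Zv)
          in b , subst (λ x → ζ x ≡ just j) v≡ (ζ-decode {v} Zv)

        apart-edge : ∀ i j → (∀ b → copy b ≢ just i) →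
          (∀ a b → ζ (inj₁ a) ≡ just i → copy b ≡ just j → h a b ≡ c b) →
          ∀ x y → ζ x ≡ just i → ζ y ≡ just j → InCopy γ y → ¬ Adjacent x y
        apart-edge i j i∌B apart (inj₁ a)        _ ζx ζy (b , refl) adj         = adj (apart a b ζx ζy)
        apart-edge i j i∌B apart (inj₂ (_ , b′)) _ ζx ζy (b , refl) (refl , _) = i∌B b′ ζx

    Allowed : Fin (P ^ n) → Fin n → Fin P → Set
    Allowed γ b x = ∀ a → h a b ≡ c b → finToFun γ a ≢ x

    allowed? : ∀ γ b → Decidable (Allowed γ b)
    allowed? γ b x = all? (λ a → (h a b ≟ c b) →-dec ¬? (finToFun γ a ≟ x))

    palette : Vertex → List (Fin P)
    palette (inj₁ a)       = allFin P
    palette (inj₂ (γ , b)) = filter (allowed? γ b) (allFin P)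

    palette-unique : ∀ x → Unique (palette x)
    palette-unique (inj₁ a)       = Unique.allFin⁺ P
    palette-unique (inj₂ (γ , b)) = Unique.filter⁺ (allowed? γ b) (Unique.allFin⁺ P)

    module _ {κ m : ℕ} (κ+m≡P : κ + m ≡ P) (P<2n : P < n + n)
             (rare : ∀ b → ∑ (allFin n) (λ a → 𝟙 (h a b ≟ c b)) ≤ m) where

      -- Every non-neighbour of `b` in `A` forbids a single colour, and there are at most `m` of
      -- them.
      length-palette : ∀ x → κ ≤ length (palette x)
      length-palette (inj₁ a) = ≤-trans (≤-trans (m≤m+n κ m) (≤-reflexive κ+m≡P))
                                        (≤-reflexive (sym (length-tabulate {n = P} id)))
      length-palette (inj₂ (γ , b)) = +-cancelʳ-≤ m κ _ (begin
        κ + m                        ≡⟨ κ+m≡P ⟩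
        P                            ≡⟨ ∑-allFin-1 P ⟨
        ∑ (allFin P) (λ _ → 1)       ≤⟨ ∑-mono (allFin P) pointwise ⟩
        ∑ (allFin P) (λ x → 𝟙 (allowed? γ b x) + ∑ (allFin n) (forbids x))
          ≡⟨ ∑-+ (allFin P) _ _ ⟩
        ∑ (allFin P) (λ x → 𝟙 (allowed? γ b x)) + ∑ (allFin P) (λ x → ∑ (allFin n) (forbids x))
          ≤⟨ +-mono-≤ (≤-reflexive (sym (length-filter-∑ (allowed? γ b) (allFin P)))) forbidden ⟩
        length (palette (inj₂ (γ , b))) + m ∎)
        where
        open ≤-Reasoning
        forbids : Fin P → Fin n → ℕ
        forbids x a = 𝟙 (h a b ≟ c b) * 𝟙 (finToFun γ a ≟ x)
        forbidden : ∑ (allFin P) (λ x → ∑ (allFin n) (forbids x)) ≤ m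
        forbidden = begin
          ∑ (allFin P) (λ x → ∑ (allFin n) (forbids x))
            ≡⟨ ∑-comm (allFin P) (allFin n) forbids ⟩
          ∑ (allFin n) (λ a → ∑ (allFin P) (λ x → forbids x a))
            ≡⟨ ∑-cong (allFin n) (λ a → trans (∑-*ˡ (allFin P) _ (𝟙 (h a b ≟ c b)))
                 (trans (cong (𝟙 (h a b ≟ c b) *_) (∑-allFin-≟ (finToFun γ a))) (*-identityʳ _))) ⟩
          ∑ (allFin n) (λ a → 𝟙 (h a b ≟ c b))
            ≤⟨ rare b ⟩
          m ∎
        pointwise : ∀ x → 1 ≤ 𝟙 (allowed? γ b x) + ∑ (allFin n) (forbids x)
        pointwise x with allowed? γ b x
        ... | yes allowed = ≤-trans (≤-reflexive (sym (𝟙-yes (allowed? γ b x) allowed))) (m≤m+n _ _)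
        ... | no ¬allowed with ¬∀⟶∃¬ n _ (λ a → (h a b ≟ c b) →-dec ¬? (finToFun γ a ≟ x)) ¬allowed
        ...   | a , ¬imp with h a b ≟ c b | finToFun γ a ≟ x
        ...     | no h≢    | _     = contradiction (λ e → contradiction e h≢) ¬imp
        ...     | yes _    | no γ≢ = contradiction (λ _ → γ≢) ¬imp
        ...     | yes hc   | yes γx = ≤-trans
                  (≤-reflexive (sym (cong₂ _*_ (𝟙-yes (h a b ≟ c b) hc) (𝟙-yes (finToFun γ a ≟ x) γx))))
                  (≤-trans (∑-∈ (allFin n) (forbids x) (∈-allFin a)) (m≤n+m _ (𝟙 (allowed? γ b x))))

      -- In the copy indexed by the very colouring that `A` receives, edges separate `b` from its
      -- neighbours and the lists separate it from its non-neighbours. So `A` and this copy together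
      -- use `n + n` distinct colours out of `P`.
      not-choosable : ¬ Choosable graph κ
      not-choosable choosable = <⇒≱ P<2n (injective⇒≤ {f = θ ∘ splitAt n} λ {x} {y} eq →
        trans (sym (join-splitAt n n x)) (trans (cong (join n n) (θ-injective (splitAt n x) (splitAt n y) eq)) (join-splitAt n n y)))
        where
        L : ListAssignment graph
        L v = map toℕ (palette (decode v))

        coloring = choosable L
          (λ v → Unique.map⁺ toℕ-injective (palette-unique (decode v)))
          (λ v → ≤-trans (length-palette (decode v)) (≤-reflexive (sym (length-map toℕ (palette (decode v))))))

        col : Vertex → ℕ
        col x = proj₁ coloring (encode x)

        chosen : ∀ x → ∃[ z ] z ∈ palette x × col x ≡ toℕ z
        chosen x = ∈-map⁻ toℕ (subst (λ y → col x ∈ map toℕ (palette y)) (decode-encode x)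
                                     (proj₁ (proj₂ coloring) (encode x)))

        proper : ∀ x y → Adjacent x y → col x ≢ col y
        proper x y adj = proj₂ (proj₂ coloring) (encode x) (encode y)
          (subst₂ Adjacent (sym (decode-encode x)) (sym (decode-encode y)) adj)

        pick : Vertex → Fin P
        pick x = proj₁ (chosen x)

        pick-proper : ∀ x y → Adjacent x y → pick x ≢ pick y
        pick-proper x y adj eq = proper x y adj
          (trans (proj₂ (proj₂ (chosen x))) (trans (cong toℕ eq) (sym (proj₂ (proj₂ (chosen y))))))

        γ : Fin (P ^ n)
        γ = funToFin (pick ∘ inj₁)

        θ : Fin n ⊎ Fin n → Fin P
        θ (inj₁ a) = pick (inj₁ a)
        θ (inj₂ b) = pick (inj₂ (γ , b))

        A-B-differ : ∀ a b → pick (inj₁ a) ≢ pick (inj₂ (γ , b))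
        A-B-differ a b eq with h a b ≟ c b
        ... | no h≢ = pick-proper (inj₁ a) (inj₂ (γ , b)) h≢ eq
        ... | yes e = proj₂ (∈-filter⁻ (allowed? γ b) {xs = allFin P} (proj₁ (proj₂ (chosen (inj₂ (γ , b)))))) a e
                        (trans (finToFun-funToFin (pick ∘ inj₁) a) eq)

        θ-injective : ∀ x y → θ x ≡ θ y → x ≡ y
        θ-injective (inj₁ a) (inj₁ a′) eq with a ≟ a′
        ... | yes refl = refl
        ... | no ne     = contradiction eq (pick-proper (inj₁ a) (inj₁ a′) ne)
        θ-injective (inj₁ a) (inj₂ b)  eq = contradiction eq (A-B-differ a b)
        θ-injective (inj₂ b) (inj₁ a)  eq = contradiction (sym eq) (A-B-differ a b)
        θ-injective (inj₂ b) (inj₂ b′) eq with b ≟ b′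
        ... | yes refl = refl
        ... | no ne     = contradiction eq (pick-proper (inj₂ (γ , b)) (inj₂ (γ , b′)) (refl , ne))

-- Decidability of choosability and existence of the list chromatic number.

module ListChromaticNumber where

  open import Data.Nat hiding (_≟_)
  import Data.Nat.Properties as ℕ
  open import Data.Nat.Properties hiding (_≟_)
  open import Data.Fin using (toℕ; combine; remQuot; inject≤; finToFun; funToFin)
  open import Data.Fin.Properties using (_≟_; all?; any?; toℕ-injective; inject≤-injective; remQuot-combine; finToFun-funToFin)
  open import Data.List using (lookup; tabulate)
  open import Data.List.Properties using (length-tabulate; filter-all; filter-accept; filter-reject)
  open import Data.List.Membership.Propositional.Properties using (∈-lookup; ∈-filter⁻; ∈-tabulate⁻)
  open import Data.List.Relation.Unary.Any using (here)
  import Data.List.Relation.Unary.All as All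
  open import Data.List.Relation.Unary.AllPairs using ([]; _∷_)
  import Data.List.Relation.Unary.Unique.Propositional.Properties as Unique
  open import Relation.Nullary.Decidable using (_→-dec_; ¬?; map′)

  -- `finToFun` reaches every function only up to pointwise equality, hence `resp`.
  module _ {m n : ℕ} (P : (Fin m → Fin n) → Set) (resp : ∀ {f g} → f ≗ g → P f → P g) (P? : Decidable P) where

    all-functions? : Dec (∀ f → P f)
    all-functions? = map′ (λ all f → resp (finToFun-funToFin f) (all (funToFin f))) (_∘ finToFun) (all? (P? ∘ finToFun))

    any-function? : Dec (∃ P)
    any-function? = map′ (λ (k , p) → finToFun k , p)
      (λ (f , p) → funToFin f , resp (λ i → sym (finToFun-funToFin f i)) p) (any? (P? ∘ finToFun))

  module _ {P : Set} where
    fromDec : Dec P → P → P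
    fromDec (yes p) _ = p
    fromDec (no ¬p) p = contradiction p ¬p

    fromDec-irrelevant : ∀ d p p′ → fromDec d p ≡ fromDec d p′
    fromDec-irrelevant (yes _) _ _ = refl
    fromDec-irrelevant (no ¬p) p _ = contradiction p ¬p

  module _ {M : ℕ} (U : Fin M → ℕ) where
    private
      preimage : ∀ x → ∃[ m ] U m ≡ x → ∃[ m ] U m ≡ x
      preimage x = fromDec (any? (λ m → U m ℕ.≟ x))

    -- Picks one index per value of `U`. Passing through `fromDec` makes the choice depend on the
    -- value `U m` alone and not on `m`, which is what `canonical-cong` expresses.
    canonical : Fin M → Fin M
    canonical m = proj₁ (preimage (U m) (m , refl))

    U-canonical : ∀ m → U (canonical m) ≡ U m
    U-canonical m = proj₂ (preimage (U m) (m , refl))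

    canonical-cong : ∀ m m′ → U m ≡ U m′ → canonical m ≡ canonical m′
    canonical-cong m m′ eq = go (m , refl) (m′ , refl) eq
      where
      go : ∀ {x x′} (w : ∃[ m ] U m ≡ x) (w′ : ∃[ m ] U m ≡ x′) → x ≡ x′ → proj₁ (preimage x w) ≡ proj₁ (preimage x′ w′)
      go {x} w w′ refl = cong proj₁ (fromDec-irrelevant (any? (λ m → U m ℕ.≟ x)) w w′)

  lookup-injective : ∀ {A : Set} {xs : List A} → Unique xs → ∀ i j → lookup xs i ≡ lookup xs j → i ≡ j
  lookup-injective (x∉ ∷ uniq) zero    zero    e = refl
  lookup-injective (x∉ ∷ uniq) zero    (suc j) e = contradiction e (All.lookup x∉ (∈-lookup j))
  lookup-injective (x∉ ∷ uniq) (suc i) zero    e = contradiction (sym e) (All.lookup x∉ (∈-lookup i))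
  lookup-injective (x∉ ∷ uniq) (suc i) (suc j) e = cong suc (lookup-injective uniq i j e)

  length-filter-≢ : ∀ y {xs} → Unique xs → length xs ≤ suc (length (filter (λ x → ¬? (x ℕ.≟ y)) xs))
  length-filter-≢ y {[]}     []           = z≤n
  length-filter-≢ y {x ∷ xs} (x∉ ∷ uniq) with x ℕ.≟ y
  ... | yes refl rewrite filter-reject (λ x → ¬? (x ℕ.≟ y)) {x} {xs} (λ ≢ → ≢ refl)
                       | filter-all (λ x → ¬? (x ℕ.≟ y)) (All.map (_∘ sym) x∉) = ≤-refl
  ... | no x≢y   rewrite filter-accept (λ x → ¬? (x ℕ.≟ y)) {x} {xs} x≢y = s≤s (length-filter-≢ y uniq)

  -- Greedy choice: removing the chosen colour shortens each remaining list by at most one. It makes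
  -- every graph choosable at its order, which bounds the search for the least `k`.
  distinct-representatives : ∀ n (L : Fin n → List ℕ) → (∀ v → Unique (L v)) → (∀ v → n ≤ length (L v)) →
    Σ (Fin n → ℕ) λ c → (∀ v → c v ∈ L v) × (∀ u v → c u ≡ c v → u ≡ v)
  distinct-representatives zero    L uniq len = (λ ()) , (λ ()) , λ ()
  distinct-representatives (suc n) L uniq len with L zero in eq | len zero
  ... | x ∷ xs | _ =
    let ≢x? = λ y → ¬? (y ℕ.≟ x)
        L′ = λ v → filter ≢x? (L (suc v))
        (c , c∈ , c-inj) = distinct-representatives n L′ (λ v → Unique.filter⁺ ≢x? (uniq (suc v)))
          (λ v → ≤-pred (≤-trans (len (suc v)) (length-filter-≢ x (uniq (suc v)))))
        c≢x = λ v → proj₂ (∈-filter⁻ ≢x? {xs = L (suc v)} (c∈ v))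
    in (λ { zero → x ; (suc v) → c v })
     , (λ { zero → subst (x ∈_) (sym eq) (here refl) ; (suc v) → proj₁ (∈-filter⁻ ≢x? {xs = L (suc v)} (c∈ v)) })
     , λ { zero    zero    _ → refl
         ; zero    (suc v) e → contradiction (sym e) (c≢x v)
         ; (suc u) zero    e → contradiction e (c≢x u)
         ; (suc u) (suc v) e → cong suc (c-inj u v e) }

  -- Upward search from `j` with fuel `d`; the known solution `d + j` stays fixed as `j` rises and
  -- `d` falls.
  least : (P : ℕ → Set) → Decidable P → ∀ d j → 1 ≤ j → (∀ i → 1 ≤ i → i < j → ¬ P i) → P (d + j) →
          ∃[ k ] 1 ≤ k × P k × (∀ i → 1 ≤ i → i < k → ¬ P i)
  least P P? zero    j 1≤j below p = j , 1≤j , p , below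
  least P P? (suc d) j 1≤j below p with P? j
  ... | yes q = j , 1≤j , q , below
  ... | no ¬q = least P P? d (suc j) (s≤s z≤n) below′ (subst P (sym (+-suc d j)) p)
    where
    below′ : ∀ i → 1 ≤ i → i < suc j → ¬ P i
    below′ i 1≤i i<1+j with m≤n⇒m<n∨m≡n (≤-pred i<1+j)
    ... | inj₁ i<j  = below i 1≤i i<j
    ... | inj₂ refl = ¬q

  module _ (G : Graph) (adj? : ∀ u v → Dec (Graph.Adj G u v)) where
    open Graph G using (n; Adj; irrefl)

    choosable-mono : ∀ {j k} → j ≤ k → Choosable G j → Choosable G k
    choosable-mono j≤k ch L uniq len = ch L uniq (λ v → ≤-trans j≤k (len v))

    choosable-order : Choosable G n
    choosable-order L uniq len =
      let (c , c∈ , c-inj) = distinct-representatives n L uniq len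
      in c , c∈ , λ u v adj eq → irrefl (subst (Adj u) (sym (c-inj u v eq)) adj)

    -- Only the pattern of equalities between list entries matters, so the n * k entries may be
    -- relabelled by Fin (n * k); choosability then quantifies over finitely many assignments.
    module _ (k : ℕ) where
      Distinct : (Fin (n * k) → Fin (n * k)) → Set
      Distinct ℓ = ∀ (v : Fin n) (i j : Fin k) → ℓ (combine v i) ≡ ℓ (combine v j) → i ≡ j

      Proper : (Fin (n * k) → Fin (n * k)) → (Fin n → Fin k) → Set
      Proper ℓ p = ∀ u v → Adj u v → ℓ (combine u (p u)) ≢ ℓ (combine v (p v))

      FinitelyChoosable : Set
      FinitelyChoosable = ∀ ℓ → Distinct ℓ → ∃ (Proper ℓ)

      finitelyChoosable? : Dec FinitelyChoosable
      finitelyChoosable? = all-functions? (λ ℓ → Distinct ℓ → ∃ (Proper ℓ)) resp-ℓ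
        (λ ℓ → distinct? ℓ →-dec any-function? (Proper ℓ) (resp-p ℓ) (proper? ℓ))
        where
        resp-ℓ : ∀ {ℓ ℓ′} → ℓ ≗ ℓ′ → (Distinct ℓ → ∃ (Proper ℓ)) → Distinct ℓ′ → ∃ (Proper ℓ′)
        resp-ℓ eq f dist =
          let (p , proper) = f (λ v i j e → dist v i j (trans (sym (eq _)) (trans e (eq _))))
          in p , λ u v adj e → proper u v adj (trans (eq _) (trans e (sym (eq _))))
        resp-p : ∀ ℓ {p p′} → p ≗ p′ → Proper ℓ p → Proper ℓ p′
        resp-p ℓ eq proper u v adj e =
          proper u v adj (trans (cong (ℓ ∘ combine u) (eq u)) (trans e (cong (ℓ ∘ combine v) (sym (eq v)))))
        distinct? : ∀ ℓ → Dec (Distinct ℓ)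
        distinct? ℓ = all? λ v → all? λ i → all? λ j → (ℓ (combine v i) ≟ ℓ (combine v j)) →-dec (i ≟ j)
        proper? : ∀ ℓ p → Dec (Proper ℓ p)
        proper? ℓ p = all? λ u → all? λ v → adj? u v →-dec ¬? (ℓ (combine u (p u)) ≟ ℓ (combine v (p v)))

      finitely⇒choosable : FinitelyChoosable → Choosable G k
      finitely⇒choosable fin L uniq len =
        let (p , proper) = fin (canonical U) distinct
        in (λ v → entry v (p v)) , (λ v → ∈-lookup (inject≤ (p v) (len v)))
         , λ u v adj eq → proper u v adj (canonical-cong U _ _ (trans (U-combine u (p u)) (trans eq (sym (U-combine v (p v))))))
        where
        entry : Fin n → Fin k → ℕ
        entry v i = lookup (L v) (inject≤ i (len v))
        U : Fin (n * k) → ℕ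
        U m = let (v , i) = remQuot k m in entry v i
        U-combine : ∀ v i → U (combine v i) ≡ entry v i
        U-combine v i = cong (λ (v , i) → entry v i) (remQuot-combine v i)
        distinct : Distinct (canonical U)
        distinct v i j e = inject≤-injective (len v) (len v) i j (lookup-injective (uniq v) _ _
          (trans (sym (U-combine v i)) (trans (sym (U-canonical U _)) (trans (cong U e) (trans (U-canonical U _) (U-combine v j))))))

      choosable⇒finitely : Choosable G k → FinitelyChoosable
      choosable⇒finitely ch ℓ dist =
        let (c , c∈ , proper) = ch (λ v → tabulate (colour v))
              (λ v → Unique.tabulate⁺ (λ {i} {j} e → dist v i j (toℕ-injective e)))
              (λ v → ≤-reflexive (sym (length-tabulate (colour v))))
            chosen = λ v → ∈-tabulate⁻ (c∈ v)
        in proj₁ ∘ chosen , λ u v adj e → proper u v adj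
             (trans (proj₂ (chosen u)) (trans (cong toℕ e) (sym (proj₂ (chosen v)))))
        where
        colour : Fin n → Fin k → ℕ
        colour v i = toℕ (ℓ (combine v i))

      choosable? : Dec (Choosable G k)
      choosable? = map′ finitely⇒choosable choosable⇒finitely finitelyChoosable?

    list-chromatic-number : ∃ (IsListChromaticNumber G)
    -- The search starts at 1 with fuel `n`, so the known solution is `n + 1`; this also covers the
    -- empty graph.
    list-chromatic-number = least (Choosable G) choosable? n 1 ≤-refl
      (λ i 1≤i i<1 → contradiction 1≤i (<⇒≱ i<1)) (choosable-mono (m≤m+n n 1) choosable-order)

-- Rational arithmetic and assembly of the bound.

open ScatteredTables
open CliqueGluing
open ListChromaticNumber
open import Data.Nat using (ℕ; zero; suc; pred; z≤n; s≤s; _≤_; _<_; _∸_) renaming (_+_ to _+ℕ_; _*_ to _*ℕ_; _/_ to _/ℕ_; _%_ to _%ℕ_)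
import Data.Nat.Properties as ℕ
open import Data.Nat.DivMod using (m/n*n≤m; m≡m%n+[m/n]*n; m%n<n)
open import Data.Nat.Tactic.RingSolver using (solve-∀)
open import Data.Integer using (+_; -[1+_]; +≤+)
import Data.Integer as ℤ
import Data.Integer.Properties as ℤ
import Data.Integer.Tactic.RingSolver as ℤ-Solver
open import Data.Rational using (ℚ; mkℚ; _/_; 0ℚ; 1ℚ; _-_; _*_; toℚᵘ; ↧ₙ_) renaming (_<_ to _<ℚ_; _≤_ to _≤ℚ_)
import Data.Rational as ℚ
import Data.Rational.Properties as ℚ
open import Data.Rational.Unnormalised as ℚᵘ using (mkℚᵘ)
import Data.Rational.Unnormalised.Properties as ℚᵘ

-- The inequality `(2 - p / K) * t ≤ k` with `K = suc d-1`, in the cross-multiplied shape to which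
-- the order on unnormalised rationals computes.
cross-multiplied : ∀ p d-1 t k → 2 *ℕ suc d-1 *ℕ t ≤ suc d-1 *ℕ k +ℕ p *ℕ t →
  (+ 2 ℤ.* + suc d-1 ℤ.+ (ℤ.- (+ p)) ℤ.* + 1) ℤ.* + t ℤ.* + 1 ℤ.≤ + k ℤ.* + (suc (d-1 +ℕ 0) *ℕ 1)
cross-multiplied p d-1 t k le = begin
  (+ 2 ℤ.* + K ℤ.+ (ℤ.- (+ p)) ℤ.* + 1) ℤ.* + t ℤ.* + 1  ≡⟨ expand (+ K) (+ p) (+ t) ⟩
  + 2 ℤ.* + K ℤ.* + t ℤ.- + p ℤ.* + t
    ≡⟨ cong₂ ℤ._-_ (trans (cong (ℤ._* + t) (sym (ℤ.pos-* 2 K))) (sym (ℤ.pos-* (2 *ℕ K) t))) (sym (ℤ.pos-* p t)) ⟩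
  + (2 *ℕ K *ℕ t) ℤ.- + (p *ℕ t)                         ≤⟨ ℤ.+-monoˡ-≤ (ℤ.- + (p *ℕ t)) (+≤+ le) ⟩
  + (K *ℕ k +ℕ p *ℕ t) ℤ.- + (p *ℕ t)                    ≡⟨ cong (ℤ._- + (p *ℕ t)) (ℤ.pos-+ (K *ℕ k) (p *ℕ t)) ⟩
  + (K *ℕ k) ℤ.+ + (p *ℕ t) ℤ.- + (p *ℕ t)               ≡⟨ cancel (+ (K *ℕ k)) (+ (p *ℕ t)) ⟩
  + (K *ℕ k)                                             ≡⟨ cong +_ (denominator d-1 k) ⟩
  + (k *ℕ (suc (d-1 +ℕ 0) *ℕ 1))                         ≡⟨ ℤ.pos-* k _ ⟩
  + k ℤ.* + (suc (d-1 +ℕ 0) *ℕ 1)                        ∎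
  where
  open ℤ.≤-Reasoning
  K = suc d-1
  expand : ∀ K p t → (+ 2 ℤ.* K ℤ.+ (ℤ.- p) ℤ.* + 1) ℤ.* t ℤ.* + 1 ≡ + 2 ℤ.* K ℤ.* t ℤ.- p ℤ.* t
  expand = ℤ-Solver.solve-∀
  cancel : ∀ x y → x ℤ.+ y ℤ.- y ≡ x
  cancel = ℤ-Solver.solve-∀
  denominator : ∀ d k → suc d *ℕ k ≡ k *ℕ (suc (d +ℕ 0) *ℕ 1)
  denominator = solve-∀

-- A positive rational with denominator `K` is at least `1 / K`, so a loss of `t / K` from `2t` is
-- affordable.
[2-ε]t≤k : ∀ ε t k → 0ℚ <ℚ ε → 2 *ℕ ↧ₙ ε *ℕ t ≤ ↧ₙ ε *ℕ k +ℕ t →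
           ((+ 2 / 1) - ε) * (+ t / 1) ≤ℚ (+ k / 1)
[2-ε]t≤k (mkℚ (+ zero)  d-1 _) t k 0<ε le with () ← ℚ.positive 0<ε
[2-ε]t≤k (mkℚ -[1+ _ ] d-1 _) t k 0<ε le with () ← ℚ.positive 0<ε
[2-ε]t≤k ε@(mkℚ (+ p@(suc p-1)) d-1 _) t k 0<ε le = ℚ.toℚᵘ-cancel-≤ (begin
  toℚᵘ (((+ 2 / 1) - ε) * (+ t / 1))
    ≃⟨ ℚ.toℚᵘ-homo-* ((+ 2 / 1) - ε) (+ t / 1) ⟩
  toℚᵘ ((+ 2 / 1) - ε) ℚᵘ.* toℚᵘ (+ t / 1)
    ≃⟨ ℚᵘ.*-cong (ℚᵘ.≃-trans (ℚ.toℚᵘ-homo-+ (+ 2 / 1) (ℚ.- ε)) (ℚᵘ.+-congʳ (toℚᵘ (+ 2 / 1)) (ℚ.toℚᵘ-homo‿- ε)))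
                 (ℚ.toℚᵘ-fromℚᵘ (mkℚᵘ (+ t) 0)) ⟩
  (mkℚᵘ (+ 2) 0 ℚᵘ.- mkℚᵘ (+ p) d-1) ℚᵘ.* mkℚᵘ (+ t) 0
    ≤⟨ ℚᵘ.*≤* (cross-multiplied p d-1 t k (ℕ.≤-trans le (ℕ.+-monoʳ-≤ (suc d-1 *ℕ k) (ℕ.m≤m+n t (p-1 *ℕ t))))) ⟩
  mkℚᵘ (+ k) 0
    ≃⟨ ℚ.toℚᵘ-fromℚᵘ (mkℚᵘ (+ k) 0) ⟨
  toℚᵘ (+ k / 1) ∎)
  where
  open ℚᵘ.≤-Reasoning

theorem2 : (ε : ℚ) → 0ℚ <ℚ ε → ε <ℚ 1ℚ →
    ∃[ t₀ ] ∀ (t : ℕ) → t₀ ≤ t →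
    Σ Graph λ G → ¬ HasKMinor G t ×
    ∃[ k ] (IsListChromaticNumber G k × ((+ 2 / 1) - ε) * (+ t / 1) ≤ℚ (+ k / 1))
theorem2 ε 0<ε _ =
  let (t₀ , tables) = scattered-tables K (s≤s z≤n) in t₀ , λ t t₀≤t → construct t (tables t t₀≤t)
  where
  open ℕ.≤-Reasoning
  K = ↧ₙ ε
  construct : ∀ t → ∃[ n ] ∃[ u ] n +ℕ (u +ℕ u) ≡ t × 8 *ℕ K *ℕ u ≤ t × 1 ≤ u × ∃ (Scattered t n (2 *ℕ K)) →
    Σ Graph λ G → ¬ HasKMinor G t ×
    ∃[ k ] (IsListChromaticNumber G k × ((+ 2 / 1) - ε) * (+ t / 1) ≤ℚ (+ k / 1))
  construct t (n , u , n+2u≡t , 8Ku≤t , 1≤u , h , scattered-h) =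
    graph , no-minor n<t scattered-h , k , χ≡k , [2-ε]t≤k ε t k 0<ε 2Kt≤Kk+t
    where
    -- `m` is the pigeonhole bound on non-neighbours. `κ` is chosen so that the number of colours
    -- `κ + m` is `2n - 1`, one too few for two disjointly coloured cliques of size `n`.
    m = n /ℕ (2 *ℕ K)
    κ = n +ℕ n ∸ suc m
    n<2K[1+m] : n < 2 *ℕ K *ℕ suc m
    n<2K[1+m] = begin-strict
      n                                  ≡⟨ m≡m%n+[m/n]*n n (2 *ℕ K) ⟩
      n %ℕ (2 *ℕ K) +ℕ m *ℕ (2 *ℕ K)     <⟨ ℕ.+-monoˡ-< (m *ℕ (2 *ℕ K)) (m%n<n n (2 *ℕ K)) ⟩
      suc m *ℕ (2 *ℕ K)                  ≡⟨ ℕ.*-comm (suc m) (2 *ℕ K) ⟩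
      2 *ℕ K *ℕ suc m                    ∎
    2Km≤n : 2 *ℕ K *ℕ m ≤ n
    2Km≤n = ℕ.≤-trans (ℕ.≤-reflexive (ℕ.*-comm (2 *ℕ K) m)) (m/n*n≤m n (2 *ℕ K))
    n<t : n < t
    n<t = subst (n <_) n+2u≡t (ℕ.m<m+n n (ℕ.≤-trans 1≤u (ℕ.m≤m+n u u)))
    -- Together with `m ≤ n` this keeps the subtraction in `κ` from truncating.
    1≤n : 1 ≤ n
    1≤n = ℕ.+-cancelʳ-≤ (u +ℕ u) 1 n (begin
      1 +ℕ (u +ℕ u)          ≤⟨ ℕ.+-mono-≤ 1≤u (ℕ.m≤m+n (u +ℕ u) (5 *ℕ u)) ⟩
      u +ℕ (u +ℕ u +ℕ 5 *ℕ u) ≡⟨ eight u ⟩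
      8 *ℕ 1 *ℕ u            ≤⟨ ℕ.*-monoˡ-≤ u (ℕ.*-monoʳ-≤ 8 (s≤s (z≤n {pred K}))) ⟩
      8 *ℕ K *ℕ u            ≤⟨ 8Ku≤t ⟩
      t                      ≡⟨ n+2u≡t ⟨
      n +ℕ (u +ℕ u)          ∎)
      where
      eight : ∀ u → u +ℕ (u +ℕ u +ℕ 5 *ℕ u) ≡ 8 *ℕ 1 *ℕ u
      eight = solve-∀
    m≤n : m ≤ n
    m≤n = ℕ.≤-trans (ℕ.m≤m*n m (2 *ℕ K)) (m/n*n≤m n (2 *ℕ K))
    1+κ+m≡2n : suc (κ +ℕ m) ≡ n +ℕ n
    1+κ+m≡2n = trans (sym (ℕ.+-suc κ m)) (ℕ.m∸n+n≡m (ℕ.+-mono-≤ 1≤n m≤n))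
    rare = λ b → rare-value {m = m} (λ a → h a b) n<2K[1+m]
    open Gluing h (λ b → proj₁ (rare b)) (κ +ℕ m)
    ¬choosable-κ : ¬ Choosable graph κ
    ¬choosable-κ = not-choosable {m = m} refl (ℕ.≤-reflexive 1+κ+m≡2n) (λ b → proj₂ (rare b))
    adj? = λ u v → adjacent? (decode u) (decode v)
    χ = list-chromatic-number graph adj?
    k = proj₁ χ
    χ≡k = proj₂ χ
    κ<k : κ < k
    κ<k = ℕ.≰⇒> λ k≤κ → ¬choosable-κ (choosable-mono graph adj? k≤κ (proj₁ (proj₂ χ≡k)))
    2n≤k+m : n +ℕ n ≤ k +ℕ m
    2n≤k+m = ℕ.≤-trans (ℕ.≤-reflexive (sym 1+κ+m≡2n)) (ℕ.+-monoˡ-≤ m κ<k)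
    2Kt≤Kk+t : 2 *ℕ K *ℕ t ≤ K *ℕ k +ℕ t
    -- Since `2t = 2n + 4u` and `2n ≤ k + m`, the shortfall of `k` from `2t` is at most `m + 4u`,
    -- and each summand is at most `t / (2K)`.
    2Kt≤Kk+t = ℕ.*-cancelˡ-≤ 2 (begin
      2 *ℕ (2 *ℕ K *ℕ t)                       ≡⟨ cong (λ z → 2 *ℕ (2 *ℕ K *ℕ z)) n+2u≡t ⟨
      2 *ℕ (2 *ℕ K *ℕ (n +ℕ (u +ℕ u)))         ≡⟨ expand K n u ⟩
      2 *ℕ K *ℕ (n +ℕ n) +ℕ 8 *ℕ K *ℕ u        ≤⟨ ℕ.+-mono-≤ (ℕ.*-monoʳ-≤ (2 *ℕ K) 2n≤k+m) 8Ku≤t ⟩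
      2 *ℕ K *ℕ (k +ℕ m) +ℕ t                  ≡⟨ cong (_+ℕ t) (ℕ.*-distribˡ-+ (2 *ℕ K) k m) ⟩
      2 *ℕ K *ℕ k +ℕ 2 *ℕ K *ℕ m +ℕ t          ≤⟨ ℕ.+-monoˡ-≤ t (ℕ.+-monoʳ-≤ (2 *ℕ K *ℕ k) (ℕ.≤-trans 2Km≤n (ℕ.<⇒≤ n<t))) ⟩
      2 *ℕ K *ℕ k +ℕ t +ℕ t                    ≡⟨ collect K k t ⟩
      2 *ℕ (K *ℕ k +ℕ t)                       ∎)
      where
      expand : ∀ K n u → 2 *ℕ (2 *ℕ K *ℕ (n +ℕ (u +ℕ u))) ≡ 2 *ℕ K *ℕ (n +ℕ n) +ℕ 8 *ℕ K *ℕ u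
      expand = solve-∀
      collect : ∀ K k t → 2 *ℕ K *ℕ k +ℕ t +ℕ t ≡ 2 *ℕ (K *ℕ k +ℕ t)
      collect = solve-∀
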